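{- Let $k,t,r,s$ be integers with $2 \leq k \leq 10$, $2 \leq t \leq 10$, and $1 \leq r < s \leq t$. Then: (1) The weak inequality $D_k(r,t;n) \geq D_k(s,t;n)$ holds for all $n \geq 1$ if $k\geq 3$, and for all $n \geq 9$ if $k = 2$. (2) The strict inequality $D_k(r,t;n) > D_k(s,t;n)$ holds for all $n \geq 17$.
   Context: A partition of $n$ is a nonincreasing sequence $\lambda=(\lambda_1,\dots,\lambda_\ell)$ of positive integers (its parts) with sum $n$. A partition is $k$-regular if every part occurs with multiplicity less than $k$. For integers $k,t\ge 2$, $1\le r\le t$, $D_k(r,t;n)$ is the total number of parts congruent to $r$ modulo $t$ among all $k$-regular partitions of $n$, counted with multiplicity: $D_k(r,t;n) := \sum_{\lambda} \#\{j : \lambda_j \equiv r \pmod t\}$, the sum running over all $k$-regular partitions $\lambda$ of $n$. -}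

module Defs where

open import Data.List.Base
  using (List; []; _∷_; [_]; length; map; filter; upTo; cartesianProductWith)
open import Data.List.Membership.Propositional using (_∈_)
open import Data.List.Membership.Propositional.Properties
  using (∈-cartesianProductWith⁺; ∈-cartesianProductWith⁻; ∈-filter⁺; ∈-filter⁻; ∈-upTo⁺)
open import Data.List.Relation.Unary.All as All using (All; []; _∷_)
open import Data.List.Relation.Unary.AllPairs using ([]; _∷_)
open import Data.List.Relation.Unary.Any using (here; there)
open import Data.List.Relation.Unary.Linked as Linked using (Linked)
open import Data.List.Relation.Unary.Unique.Propositional using (Unique)
import Data.List.Relation.Unary.Unique.Propositional.Properties as Unique
open import Data.List.Properties using (∷-injective)
open import Data.Nat.Base
open import Data.Nat.Divisibility using (_∣_; _∣?_)
open import Data.Nat.ListAction using (sum)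
open import Data.Nat.Properties
open import Data.Product.Base using (_×_; _,_; proj₂)
open import Function.Bundles using (_⇔_; mk⇔)
open import Relation.Binary.PropositionalEquality using (_≡_; refl)
open import Relation.Nullary.Decidable using (Dec; _×-dec_)
open import Relation.Nullary.Negation using (¬_)

IsPartition : ℕ → List ℕ → Set
IsPartition n ps = Linked _≥_ ps × All (1 ≤_) ps × sum ps ≡ n

isPartition? : ∀ n ps → Dec (IsPartition n ps)
isPartition? n ps = Linked.linked? _≥?_ ps ×-dec All.all? (1 ≤?_) ps ×-dec (sum ps ≟ n)

multiplicity : ℕ → List ℕ → ℕ
multiplicity p ps = length (filter (p ≟_) ps)

IsRegular : ℕ → List ℕ → Set
IsRegular k ps = All (λ p → multiplicity p ps < k) ps

isRegular? : ∀ k ps → Dec (IsRegular k ps)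
isRegular? k ps = All.all? (λ p → multiplicity p ps <? k) ps

IsRegularPartition : ℕ → ℕ → List ℕ → Set
IsRegularPartition k n ps = IsPartition n ps × IsRegular k ps

isRegularPartition? : ∀ k n ps → Dec (IsRegularPartition k n ps)
isRegularPartition? k n ps = isPartition? n ps ×-dec isRegular? k ps

-- All lists of length at most ℓ with entries from xs.
words : ∀ {A : Set} → ℕ → List A → List (List A)
words zero    xs = [ [] ]
words (suc ℓ) xs = [] ∷ cartesianProductWith _∷_ xs (words ℓ xs)

-- A partition of n has at most n parts, each at most n, so this search misses
-- none: see ∈-regularPartitions and regularPartitions-unique below.
regularPartitions : ℕ → ℕ → List (List ℕ)
regularPartitions k n = filter (isRegularPartition? k n) (words n (upTo (suc n)))

infix 4 _≡_[mod_] _≡?_[mod_]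

_≡_[mod_] : ℕ → ℕ → ℕ → Set
a ≡ b [mod t ] = t ∣ ∣ a - b ∣

_≡?_[mod_] : ∀ a b t → Dec (a ≡ b [mod t ])
a ≡? b [mod t ] = t ∣? ∣ a - b ∣

partsCongruentTo : ℕ → ℕ → List ℕ → ℕ
partsCongruentTo r t ps = length (filter (λ p → p ≡? r [mod t ]) ps)

D : ℕ → ℕ → ℕ → ℕ → ℕ
D k r t n = sum (map (partsCongruentTo r t) (regularPartitions k n))

∈-words : ∀ {A : Set} {ℓ} {xs : List A} {ys} →
          length ys ≤ ℓ → All (_∈ xs) ys → ys ∈ words ℓ xs
∈-words {ℓ = zero}  z≤n     []       = here refl
∈-words {ℓ = suc ℓ} z≤n     []       = here refl
∈-words {ℓ = suc ℓ} (s≤s l) (y ∷ ys) = there (∈-cartesianProductWith⁺ _∷_ y (∈-words l ys))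

words-unique : ∀ {A : Set} ℓ {xs : List A} → Unique xs → Unique (words ℓ xs)
words-unique zero         u = [] ∷ []
words-unique (suc ℓ) {xs} u =
  All.tabulate nonempty ∷ Unique.cartesianProductWith⁺ _∷_ ∷-injective u (words-unique ℓ u)
  where
  nonempty : ∀ {ys} → ys ∈ cartesianProductWith _∷_ xs (words ℓ xs) → ¬ ([] ≡ ys)
  nonempty ys∈ refl with ∈-cartesianProductWith⁻ _∷_ xs (words ℓ xs) ys∈
  ... | _ , _ , _ , _ , ()

length≤sum : ∀ {ps} → All (1 ≤_) ps → length ps ≤ sum ps
length≤sum []       = z≤n
length≤sum (p ∷ ps) = +-mono-≤ p (length≤sum ps)

parts≤sum : ∀ ps → All (_≤ sum ps) ps
parts≤sum []       = []
parts≤sum (p ∷ ps) = m≤m+n p (sum ps) ∷ All.map (λ q≤ → ≤-trans q≤ (m≤n+m (sum ps) p)) (parts≤sum ps)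

∈-regularPartitions : ∀ {k n ps} → ps ∈ regularPartitions k n ⇔ IsRegularPartition k n ps
∈-regularPartitions {k} {n} {ps} = mk⇔
  (λ ps∈ → proj₂ (∈-filter⁻ (isRegularPartition? k n) {xs = words n (upTo (suc n))} ps∈))
  (λ { π@((_ , pos , refl) , _) → ∈-filter⁺ (isRegularPartition? k n)
       (∈-words (length≤sum pos) (All.map (λ p≤ → ∈-upTo⁺ (s≤s p≤)) (parts≤sum ps))) π })

regularPartitions-unique : ∀ k n → Unique (regularPartitions k n)
regularPartitions-unique k n =
  Unique.filter⁺ (isRegularPartition? k n) (words-unique n (Unique.upTo⁺ (suc n)))

{-# OPTIONS --safe #-}
module Submission where

-- It suffices to compare consecutive parts. Let T p be the number of times that p occurs in
-- all k-regular partitions of n, so that D k r t n is the sum of T p over p ≡ r modulo t.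
-- If T (p + 1) ≤ T p for all p ≥ 1, then D k (r + 1) t n ≤ D k r t n for 1 ≤ r < t, strictly if
-- T (r + 1) < T r, and the theorem follows by going from r to s in unit steps
-- (T-antitone, T-decreasing, D-antitone, D-decreasing-step).
--
-- Fix p, put q = p + 1, and let F n be the number of k-regular partitions of n without parts p
-- and q. Sorting by the multiplicities a of p and b of q, T p is the sum over a, b < k of
-- a * F (n - a p - b q), and T q is the same sum with factor b. Pairing (a, b) with (b, a), the
-- rearrangement inequality shows that T q ≤ T p as soon as F is nondecreasing, and that
-- F (n - q) < F (n - p) gives strictness (T-compare). In terms of generating functions, F has to
-- have nonnegative coefficients after multiplication by 1 - x.
--
-- Write [m] = 1 + x^m + … + x^((k-1)m). Since (1 - x^o) [o] = 1 - x^(ko), multiplying by 1 - x^o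
-- consumes the factors [o], [ko], [k²o], … one after the other, and if all of them are present
-- then the other factors are left: a series with nonnegative coefficients (chain-gap). With
-- o = 1 this settles the case that neither p nor q is a power of k. If P = k^(i+1) is one of p, q,
-- the chain of 1 stops at P and leaves 1 - x^P times the product without 1, k, …, k^i. Except
-- for a few small p, P is a sum of integers o among 2, 3 and 5 whose chains avoid the
-- powers of k as well as p and q, and 1 - x^P is a combination of the 1 - x^o with
-- nonnegative coefficients (span-power, descent). In both cases the coefficient left over at
-- n - p counts partitions of n - p, and for n ≥ 32 and p ≤ 9 it is positive because of a partition
-- into one or two parts that are at least 11 and not divisible by k (witness).
--
-- The exceptions are p = 1, p ≤ 4 for k = 2, and p ≤ 3 for k = 3 (Special). There the inequality
-- F n ≤ F (n + 1) is proved for n beyond the degree of the product of the [m] with m < p: adding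
-- 1 to the largest part is injective, and possible once that part exceeds p (grow-step, grow). For
-- k ≥ 3 the partitions whose largest part occurs twice, for k = 2 those whose largest two parts are
-- consecutive, are not reached, which makes the inequality strict (strict-growth).
--
-- What remains is n < 32 and p ≤ 9, where T p is computed (tables-antitone).

open import Defs
open import Algebra.Properties.CommutativeSemigroup using (interchange; x∙yz≈y∙xz)
open import Data.Bool.Base using (if_then_else_; true; false)
open import Data.List.Base
  using (List; []; _∷_; [_]; _++_; applyUpTo; filter; length; map; replicate)
open import Data.List.Membership.Propositional using (_∈_)
open import Data.List.Membership.Propositional.Properties
  using (∈-++⁻; ∈-++⁺ˡ; ∈-++⁺ʳ; ∈-map⁻; ∈-map⁺)
open import Data.List.Membership.Propositional.Properties.WithK using (unique∧set⇒bag)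
open import Data.List.Properties
  using (filter-++; filter-all; filter-none; length-++; length-replicate; map-∘; map-++; map-cong-local; ++-cancelˡ)
open import Data.List.Relation.Binary.BagAndSetEquality using (∼bag⇒↭)
open import Data.List.Relation.Binary.Permutation.Propositional using (_↭_)
open import Data.List.Relation.Binary.Permutation.Propositional.Properties
  using () renaming (map⁺ to ↭-map⁺)
open import Data.List.Relation.Unary.All as All using (All; []; _∷_)
import Data.List.Relation.Unary.All.Properties as All
open import Data.List.Relation.Unary.AllPairs using ([]; _∷_)
open import Data.List.Relation.Unary.Any using (here)
open import Data.List.Relation.Unary.Linked as Linked using (Linked; []; [-]; _∷_)
open import Data.List.Relation.Unary.Linked.Properties using (Linked⇒All)
open import Data.List.Relation.Unary.Unique.Propositional using (Unique)
import Data.List.Relation.Unary.Unique.Propositional.Properties as Unique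
open import Data.Nat.Base
open import Data.Nat.Divisibility
open import Data.Nat.ListAction using (sum)
open import Data.Nat.ListAction.Properties using (sum-++; sum-↭)
open import Data.Nat.Properties
open import Data.Nat.Tactic.RingSolver using (solve-∀)
open import Data.Product.Base using (_×_; _,_; proj₁; proj₂; ∃; ∃₂)
open import Data.Sum.Base using (_⊎_; inj₁; inj₂)
open import Function.Base using (id; _∘_)
open import Function.Bundles using (mk⇔; module Equivalence)
open import Relation.Binary.PropositionalEquality hiding ([_])
open import Relation.Nullary.Decidable
  using (Dec; yes; no; does; dec-true; dec-false; from-yes; map′; ¬?; _×-dec_; _⊎-dec_; _→-dec_)
open import Relation.Nullary.Negation using (¬_; contradiction)
open import Relation.Unary using (Decidable)

-- Sums and shifted sequences

-- The sum of f 0, …, f (k - 1).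
sumTo : ℕ → (ℕ → ℕ) → ℕ
sumTo zero    f = 0
sumTo (suc k) f = sumTo k f + f k

-- The sequence f moved up by d places, that is n ↦ f (n - d), with value z for n < d.
shiftBy : ∀ {A : Set} → A → ℕ → (ℕ → A) → ℕ → A
shiftBy z zero    f n       = f n
shiftBy z (suc d) f zero    = z
shiftBy z (suc d) f (suc n) = shiftBy z d f n

-- Multiplication of a power series by x^d.
shift : ℕ → (ℕ → ℕ) → ℕ → ℕ
shift = shiftBy 0

sumTo-cong : ∀ k {f g : ℕ → ℕ} → (∀ i → i < k → f i ≡ g i) → sumTo k f ≡ sumTo k g
sumTo-cong zero    eq = refl
sumTo-cong (suc k) eq = cong₂ _+_ (sumTo-cong k (λ i i<k → eq i (m<n⇒m<1+n i<k))) (eq k ≤-refl)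

sumTo-mono : ∀ k {f g : ℕ → ℕ} → (∀ i → i < k → f i ≤ g i) → sumTo k f ≤ sumTo k g
sumTo-mono zero    le = z≤n
sumTo-mono (suc k) le = +-mono-≤ (sumTo-mono k (λ i i<k → le i (m<n⇒m<1+n i<k))) (le k ≤-refl)

sumTo-zero : ∀ k → sumTo k (λ _ → 0) ≡ 0
sumTo-zero zero    = refl
sumTo-zero (suc k) = trans (+-identityʳ _) (sumTo-zero k)

sumTo-+ : ∀ k (f g : ℕ → ℕ) → sumTo k (λ i → f i + g i) ≡ sumTo k f + sumTo k g
sumTo-+ zero    f g = refl
sumTo-+ (suc k) f g = trans (cong (_+ (f k + g k)) (sumTo-+ k f g)) (interchange +-commutativeSemigroup (sumTo k f) (sumTo k g) (f k) (g k))

sumTo-* : ∀ k c (f : ℕ → ℕ) → sumTo k (λ i → c * f i) ≡ c * sumTo k f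
sumTo-* zero    c f = sym (*-zeroʳ c)
sumTo-* (suc k) c f = trans (cong (_+ c * f k) (sumTo-* k c f)) (sym (*-distribˡ-+ c (sumTo k f) (f k)))

sumTo-swap : ∀ k l (f : ℕ → ℕ → ℕ) → sumTo k (λ i → sumTo l (f i)) ≡ sumTo l (λ j → sumTo k (λ i → f i j))
sumTo-swap zero    l f = sym (sumTo-zero l)
sumTo-swap (suc k) l f = trans (cong (_+ sumTo l (f k)) (sumTo-swap k l f)) (sym (sumTo-+ l (λ j → sumTo k (λ i → f i j)) (f k)))

shift-mono : ∀ d {f g : ℕ → ℕ} {n} → (∀ m → m ≤ n → f m ≤ g m) → shift d f n ≤ shift d g n
shift-mono zero            le = le _ ≤-refl
shift-mono (suc d) {n = zero}  le = z≤n
shift-mono (suc d) {n = suc n} le = shift-mono d (λ m m≤n → le m (m≤n⇒m≤1+n m≤n))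

shift-cong : ∀ d {f g : ℕ → ℕ} {n} → (∀ m → m ≤ n → f m ≡ g m) → shift d f n ≡ shift d g n
shift-cong d eq = ≤-antisym (shift-mono d (λ m m≤n → ≤-reflexive (eq m m≤n)))
                            (shift-mono d (λ m m≤n → ≤-reflexive (sym (eq m m≤n))))

shift-shift : ∀ d e (f : ℕ → ℕ) n → shift d (shift e f) n ≡ shift (d + e) f n
shift-shift zero    e f n       = refl
shift-shift (suc d) e f zero    = refl
shift-shift (suc d) e f (suc n) = shift-shift d e f n

shift-beyond : ∀ {d n} (f : ℕ → ℕ) → n < d → shift d f n ≡ 0
shift-beyond {suc d} {zero}  f _         = refl
shift-beyond {suc d} {suc n} f (s≤s n<d) = shift-beyond f n<d

shiftBy-exact : ∀ {A : Set} {z : A} d f n → shiftBy z d f (d + n) ≡ f n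
shiftBy-exact zero    f n = refl
shiftBy-exact (suc d) f n = shiftBy-exact d f n

shift-exact : ∀ d (f : ℕ → ℕ) n → shift d f (d + n) ≡ f n
shift-exact d f n = shiftBy-exact d f n

shift-zero : ∀ d n → shift d (λ _ → 0) n ≡ 0
shift-zero zero    n       = refl
shift-zero (suc d) zero    = refl
shift-zero (suc d) (suc n) = shift-zero d n

shift-+ : ∀ d (f g : ℕ → ℕ) n → shift d (λ m → f m + g m) n ≡ shift d f n + shift d g n
shift-+ zero    f g n       = refl
shift-+ (suc d) f g zero    = refl
shift-+ (suc d) f g (suc n) = shift-+ d f g n

shift-* : ∀ d c (f : ℕ → ℕ) n → shift d (λ m → c * f m) n ≡ c * shift d f n
shift-* zero    c f n       = refl
shift-* (suc d) c f zero    = sym (*-zeroʳ c)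
shift-* (suc d) c f (suc n) = shift-* d c f n

shift-sumTo : ∀ d k (g : ℕ → ℕ → ℕ) n → shift d (λ m → sumTo k (λ a → g a m)) n ≡ sumTo k (λ a → shift d (g a) n)
shift-sumTo d zero    g n = shift-zero d n
shift-sumTo d (suc k) g n = trans (shift-+ d (λ m → sumTo k (λ a → g a m)) (g k) n)
                                  (cong (_+ shift d (g k) n) (shift-sumTo d k g n))

-- Weighted generating functions

-- A weight ω x a for every part x and multiplicity a.
Weights : Set
Weights = ℕ → ℕ → ℕ

-- Multiplication of the series f by the sum over a < k of w a * x^(a m).
factor : ℕ → (ℕ → ℕ) → ℕ → (ℕ → ℕ) → ℕ → ℕ
factor k w m f n = sumTo k (λ a → w a * shift (a * m) f n)

-- The series 1.
δ : ℕ → ℕ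
δ zero    = 1
δ (suc _) = 0

-- W k ω N is the product over x ≤ N of the sums over a < k of ω x a * y^(a x), as a series in y:
-- its value at n is the sum, over the partitions of n into parts at most N with multiplicities
-- less than k, of the product of the weights of all multiplicities.
W : ℕ → Weights → ℕ → ℕ → ℕ
W k ω zero    = δ
W k ω (suc N) = factor k (ω (suc N)) (suc N) (W k ω N)

-- The weights of a part that must not occur.
unit : ℕ → ℕ
unit zero    = 1
unit (suc _) = 0

-- The weights of a part that is free to occur.
one : ℕ → ℕ
one _ = 1

-- The weights ω with those of the part x replaced by w.
infixl 5 _[_↦_]
_[_↦_] : Weights → ℕ → (ℕ → ℕ) → Weights
(ω [ x ↦ w ]) y a = if does (y ≟ x) then w a else ω y a

factor-mono : ∀ k {w v : ℕ → ℕ} m {f g : ℕ → ℕ} {n} → (∀ a → w a ≤ v a) → (∀ j → j ≤ n → f j ≤ g j) →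
              factor k w m f n ≤ factor k v m g n
factor-mono k m w≤v f≤g = sumTo-mono k (λ a _ → *-mono-≤ (w≤v a) (shift-mono (a * m) f≤g))

factor-cong : ∀ k {w v : ℕ → ℕ} m {f g : ℕ → ℕ} {n} → (∀ a → w a ≡ v a) → (∀ j → j ≤ n → f j ≡ g j) →
              factor k w m f n ≡ factor k v m g n
factor-cong k m w≡v f≡g = sumTo-cong k (λ a _ → cong₂ _*_ (w≡v a) (shift-cong (a * m) f≡g))

factor-factor : ∀ k w v m l f n → factor k w m (factor k v l f) n ≡
                sumTo k (λ a → sumTo k (λ b → w a * (v b * shift (a * m + b * l) f n)))
factor-factor k w v m l f n = sumTo-cong k λ a _ → begin
  w a * shift (a * m) (factor k v l f) n
    ≡⟨ cong (w a *_) (shift-sumTo (a * m) k (λ b → λ j → v b * shift (b * l) f j) n) ⟩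
  w a * sumTo k (λ b → shift (a * m) (λ j → v b * shift (b * l) f j) n)
    ≡⟨ cong (w a *_) (sumTo-cong k λ b _ → trans (shift-* (a * m) (v b) (shift (b * l) f) n)
                                                 (cong (v b *_) (shift-shift (a * m) (b * l) f n))) ⟩
  w a * sumTo k (λ b → v b * shift (a * m + b * l) f n)
    ≡⟨ sumTo-* k (w a) _ ⟨
  sumTo k (λ b → w a * (v b * shift (a * m + b * l) f n)) ∎
  where open ≡-Reasoning

factor-comm : ∀ k w v m l f n → factor k w m (factor k v l f) n ≡ factor k v l (factor k w m f) n
factor-comm k w v m l f n = begin
  factor k w m (factor k v l f) n
    ≡⟨ factor-factor k w v m l f n ⟩
  sumTo k (λ a → sumTo k (λ b → w a * (v b * shift (a * m + b * l) f n)))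
    ≡⟨ sumTo-swap k k _ ⟩
  sumTo k (λ b → sumTo k (λ a → w a * (v b * shift (a * m + b * l) f n)))
    ≡⟨ sumTo-cong k (λ b _ → sumTo-cong k λ a _ →
         trans (x∙yz≈y∙xz *-commutativeSemigroup (w a) (v b) _) (cong (λ d → v b * (w a * shift d f n)) (+-comm (a * m) (b * l)))) ⟩
  sumTo k (λ b → sumTo k (λ a → v b * (w a * shift (b * l + a * m) f n)))
    ≡⟨ factor-factor k v w l m f n ⟨
  factor k v l (factor k w m f) n ∎
  where open ≡-Reasoning

-- Only the term a = 0 survives.
factor-constant : ∀ k w m f n → w 0 ≡ 1 → (∀ a → w (suc a) * shift (suc a * m) f n ≡ 0) →
                  factor (suc k) w m f n ≡ f n
factor-constant zero    w m f n w0 rest = trans (cong (_* f n) w0) (*-identityˡ (f n))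
factor-constant (suc k) w m f n w0 rest =
  trans (cong₂ _+_ (factor-constant k w m f n w0 rest) (rest k)) (+-identityʳ (f n))

factor-unit : ∀ {k} m f n → 1 ≤ k → factor k unit m f n ≡ f n
factor-unit {suc k} m f n _ = factor-constant k unit m f n refl (λ _ → refl)

factor-below : ∀ {k w m n} f → 1 ≤ k → w 0 ≡ 1 → n < m → factor k w m f n ≡ f n
factor-below {suc k} {w} {m} {n} f _ w0 n<m = factor-constant k w m f n w0 λ a →
  trans (cong (w (suc a) *_) (shift-beyond f (≤-trans n<m (m≤m+n m (a * m))))) (*-zeroʳ (w (suc a)))

-- (1 - x^m) (1 + x^m + … + x^((k-1)m)) = 1 - x^(km), without subtraction.
factor-telescope : ∀ k m f n → factor k one m f n + shift (k * m) f n ≡ f n + shift m (factor k one m f) n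
factor-telescope zero    m f n = sym (trans (cong (f n +_) (shift-zero m n)) (+-identityʳ (f n)))
factor-telescope (suc k) m f n = begin
  factor k one m f n + 1 * shift (k * m) f n + shift (m + k * m) f n
    ≡⟨ cong (λ z → factor k one m f n + z + shift (m + k * m) f n) (*-identityˡ _) ⟩
  factor k one m f n + shift (k * m) f n + shift (m + k * m) f n
    ≡⟨ cong (_+ shift (m + k * m) f n) (factor-telescope k m f n) ⟩
  f n + shift m (factor k one m f) n + shift (m + k * m) f n
    ≡⟨ +-assoc (f n) _ _ ⟩
  f n + (shift m (factor k one m f) n + shift (m + k * m) f n)
    ≡⟨ cong (λ z → f n + (shift m (factor k one m f) n + z)) (trans (sym (shift-shift m (k * m) f n))
         (shift-cong m (λ j _ → sym (*-identityˡ (shift (k * m) f j))))) ⟩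
  f n + (shift m (factor k one m f) n + shift m (λ j → 1 * shift (k * m) f j) n)
    ≡⟨ cong (f n +_) (shift-+ m (factor k one m f) (λ j → 1 * shift (k * m) f j) n) ⟨
  f n + shift m (factor (suc k) one m f) n ∎
  where open ≡-Reasoning

update-same : ∀ ω x w a → (ω [ x ↦ w ]) x a ≡ w a
update-same ω x w a rewrite dec-true (x ≟ x) refl = refl

update-other : ∀ ω x {y} w a → y ≢ x → (ω [ x ↦ w ]) y a ≡ ω y a
update-other ω x {y} w a y≢x rewrite dec-false (y ≟ x) y≢x = refl

W-mono : ∀ k {ω ψ} N {n} → (∀ x → 1 ≤ x → x ≤ N → ∀ a → ω x a ≤ ψ x a) → W k ω N n ≤ W k ψ N n
W-mono k zero    le = ≤-refl
W-mono k (suc N) le = factor-mono k (suc N) (le (suc N) (s≤s z≤n) ≤-refl)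
  (λ j _ → W-mono k N (λ x 1≤x x≤N → le x 1≤x (m≤n⇒m≤1+n x≤N)))

W-cong : ∀ k {ω ψ} N {n} → (∀ x → 1 ≤ x → x ≤ N → ∀ a → ω x a ≡ ψ x a) → W k ω N n ≡ W k ψ N n
W-cong k N eq = ≤-antisym (W-mono k N (λ x l u a → ≤-reflexive (eq x l u a)))
                          (W-mono k N (λ x l u a → ≤-reflexive (sym (eq x l u a))))

-- Parts larger than n do not contribute to the coefficient at n.
W-stable : ∀ {k ω N N′ n} → 1 ≤ k → n ≤ N → N ≤ N′ → (∀ x → N < x → ω x 0 ≡ 1) → W k ω N′ n ≡ W k ω N n
W-stable {k} {ω} {N} {N′} {n} 1≤k n≤N N≤N′ ω0 = go (≤⇒≤′ N≤N′)
  where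
  go : ∀ {M} → N ≤′ M → W k ω M n ≡ W k ω N n
  go (≤′-reflexive refl) = refl
  go (≤′-step {M} N≤M) = trans
    (factor-below {w = ω (suc M)} (W k ω M) 1≤k (ω0 (suc M) (s≤s (≤′⇒≤ N≤M))) (s≤s (≤-trans n≤N (≤′⇒≤ N≤M))))
    (go N≤M)

-- The factor of a part m can be moved to the front.
W-extract : ∀ {k} ω {m N} n → 1 ≤ k → 1 ≤ m → m ≤ N →
            W k ω N n ≡ factor k (ω m) m (W k (ω [ m ↦ unit ]) N) n
W-extract {k} ω {m} {N} n 1≤k 1≤m m≤N = go (≤⇒≤′ m≤N) 1≤m n
  where
  ω′ = ω [ m ↦ unit ]
  go : ∀ {M} → m ≤′ M → 1 ≤ m → ∀ n → W k ω M n ≡ factor k (ω m) m (W k ω′ M) n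
  go {suc M} (≤′-reflexive refl) _ n = factor-cong k {ω m} m (λ _ → refl) λ j _ → sym (begin
    factor k (ω′ m) m (W k ω′ M) j ≡⟨ factor-cong k {ω′ m} {unit} m (update-same ω m unit) (λ _ _ → refl) ⟩
    factor k unit m (W k ω′ M) j   ≡⟨ factor-unit m (W k ω′ M) j 1≤k ⟩
    W k ω′ M j                     ≡⟨ W-cong k M (λ x _ x≤M a → update-other ω m unit a (<⇒≢ (s≤s x≤M))) ⟩
    W k ω M j                      ∎)
    where open ≡-Reasoning
  go {suc M} (≤′-step m≤M) 1≤m n = begin
    factor k (ω (suc M)) (suc M) (W k ω M) n
      ≡⟨ factor-cong k (suc M) (λ a → sym (update-other ω m unit a (>⇒≢ (s≤s (≤′⇒≤ m≤M))))) (λ j _ → go m≤M 1≤m j) ⟩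
    factor k (ω′ (suc M)) (suc M) (factor k (ω m) m (W k ω′ M)) n
      ≡⟨ factor-comm k (ω′ (suc M)) (ω m) (suc M) m (W k ω′ M) n ⟩
    factor k (ω m) m (W k ω′ (suc M)) n ∎
    where open ≡-Reasoning

update-cong : ∀ ω ψ x w {y} a → (y ≢ x → ω y a ≡ ψ y a) → (ω [ x ↦ w ]) y a ≡ (ψ [ x ↦ w ]) y a
update-cong ω ψ x w {y} a eq with y ≟ x
... | yes refl = trans (update-same ω x w a) (sym (update-same ψ x w a))
... | no  y≢x  = trans (update-other ω x w a y≢x) (trans (eq y≢x) (sym (update-other ψ x w a y≢x)))

-- Comparing the occurrences of p and p + 1

ones : Weights
ones _ = one

-- For 1 ≤ p ≤ n, the number of occurrences of the part p in all k-regular partitions of n: every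
-- partition is weighted by the multiplicity of p. The value for p > n is irrelevant.
T : ℕ → ℕ → ℕ → ℕ
T k p n = W k (ones [ p ↦ id ]) n n

-- The parts p and p + 1 are forbidden.
omit₂ : ℕ → Weights
omit₂ p = ones [ p ↦ unit ] [ suc p ↦ unit ]

sumSquare : ℕ → (ℕ → ℕ → ℕ) → ℕ
sumSquare k g = sumTo k (λ a → sumTo k (g a))

-- The square of side k + 1 is the square of side k, two edges and a corner.
sumSquare-suc : ∀ k g → sumSquare (suc k) g ≡ sumSquare k g + sumTo k (λ i → g i k + g k i) + g k k
sumSquare-suc k g = begin
  sumTo k (λ a → sumTo k (g a) + g a k) + (sumTo k (g k) + g k k)
    ≡⟨ cong (_+ (sumTo k (g k) + g k k)) (sumTo-+ k (λ a → sumTo k (g a)) (λ a → g a k)) ⟩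
  sumSquare k g + sumTo k (λ a → g a k) + (sumTo k (g k) + g k k)
    ≡⟨ regroup (sumSquare k g) _ _ _ ⟩
  sumSquare k g + (sumTo k (λ a → g a k) + sumTo k (g k)) + g k k
    ≡⟨ cong (λ z → sumSquare k g + z + g k k) (sumTo-+ k (λ a → g a k) (g k)) ⟨
  sumSquare k g + sumTo k (λ i → g i k + g k i) + g k k ∎
  where
  open ≡-Reasoning
  regroup : ∀ a b c d → a + b + (c + d) ≡ a + (b + c) + d
  regroup = solve-∀

rearrangement₂ : ∀ {i j x y} → i ≤ j → x ≤ y → j * x + i * y ≤ i * x + j * y
rearrangement₂ {i} {j} {x} {y} i≤j x≤y with m≤n⇒∃[o]m+o≡n i≤j | m≤n⇒∃[o]m+o≡n x≤y
... | d , refl | e , refl = begin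
  (i + d) * x + i * (x + e)          ≤⟨ m≤m+n _ (d * e) ⟩
  (i + d) * x + i * (x + e) + d * e  ≡⟨ lemma i d x e ⟩
  i * x + (i + d) * (x + e)          ∎
  where
  open ≤-Reasoning
  lemma : ∀ i d x e → (i + d) * x + i * (x + e) + d * e ≡ i * x + (i + d) * (x + e)
  lemma = solve-∀

-- X (1, 0) exceeding X (0, 1) by ε carries over to the sums.
rearrangement : ∀ {ε k} (X : ℕ → ℕ → ℕ) → 2 ≤ k →
  (∀ {a b} → b < a → a < k → X b a ≤ X a b) → ε + X 0 1 ≤ X 1 0 →
  ε + sumSquare k (λ a b → b * X a b) ≤ sumSquare k (λ a b → a * X a b)
rearrangement {ε} X 2≤k X-mono gap = go (≤⇒≤′ 2≤k) X-mono
  where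
  open ≤-Reasoning
  go : ∀ {k} → 2 ≤′ k → (∀ {a b} → b < a → a < k → X b a ≤ X a b) →
       ε + sumSquare k (λ a b → b * X a b) ≤ sumSquare k (λ a b → a * X a b)
  go (≤′-reflexive refl) _ = begin
    ε + (X 0 1 + 0 + (X 1 1 + 0))   ≡⟨ lemma ε (X 0 1) (X 1 1 + 0) ⟩
    ε + X 0 1 + (X 1 1 + 0)         ≤⟨ +-monoˡ-≤ (X 1 1 + 0) gap ⟩
    X 1 0 + (X 1 1 + 0)             ≡⟨ cong (_+ (X 1 1 + 0)) (sym (+-identityʳ (X 1 0))) ⟩
    X 1 0 + 0 + (X 1 1 + 0)         ∎
    where
    lemma : ∀ a b c → a + (b + 0 + c) ≡ a + b + c
    lemma = solve-∀
  go {suc k} (≤′-step 2≤k) mono = begin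
    ε + sumSquare (suc k) (λ a b → b * X a b)
      ≡⟨ cong (ε +_) (sumSquare-suc k _) ⟩
    ε + (sumSquare k (λ a b → b * X a b) + sumTo k (λ i → k * X i k + i * X k i) + k * X k k)
      ≡⟨ lemma ε (sumSquare k (λ a b → b * X a b)) _ _ ⟩
    ε + sumSquare k (λ a b → b * X a b) + sumTo k (λ i → k * X i k + i * X k i) + k * X k k
      ≤⟨ +-monoˡ-≤ (k * X k k) (+-mono-≤ (go 2≤k (λ b<a a<k → mono b<a (m<n⇒m<1+n a<k)))
           (sumTo-mono k λ i i<k → rearrangement₂ {i} {k} (<⇒≤ i<k) (mono i<k ≤-refl))) ⟩
    sumSquare k (λ a b → a * X a b) + sumTo k (λ i → i * X i k + k * X k i) + k * X k k
      ≡⟨ sumSquare-suc k _ ⟨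
    sumSquare (suc k) (λ a b → a * X a b) ∎
    where
    lemma : ∀ a b c d → a + (b + c + d) ≡ a + b + c + d
    lemma = solve-∀

W-extract₂ : ∀ {k} ω {p N} n → 1 ≤ k → 1 ≤ p → suc p ≤ N → (∀ x a → x ≢ p → x ≢ suc p → ω x a ≡ 1) →
  W k ω N n ≡ sumSquare k (λ a b → ω p a * (ω (suc p) b * shift (a * p + b * suc p) (W k (omit₂ p) N) n))
W-extract₂ {k} ω {p} {N} n 1≤k 1≤p q≤N ω≡1 = begin
  W k ω N n
    ≡⟨ W-extract ω n 1≤k 1≤p (<⇒≤ q≤N) ⟩
  factor k (ω p) p (W k (ω [ p ↦ unit ]) N) n
    ≡⟨ factor-cong k {ω p} p (λ _ → refl) (λ j _ → trans
         (W-extract (ω [ p ↦ unit ]) j 1≤k (s≤s z≤n) q≤N)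
         (factor-cong k {(ω [ p ↦ unit ]) (suc p)} (suc p)
           (λ b → update-other ω p unit b 1+n≢n)
           (λ _ _ → W-cong k N (λ x _ _ → agree x)))) ⟩
  factor k (ω p) p (factor k (ω (suc p)) (suc p) (W k (omit₂ p) N)) n
    ≡⟨ factor-factor k (ω p) (ω (suc p)) p (suc p) _ n ⟩
  sumSquare k (λ a b → ω p a * (ω (suc p) b * shift (a * p + b * suc p) (W k (omit₂ p) N) n)) ∎
  where
  open ≡-Reasoning
  agree : ∀ x a → (ω [ p ↦ unit ] [ suc p ↦ unit ]) x a ≡ omit₂ p x a
  agree x a = update-cong (ω [ p ↦ unit ]) (ones [ p ↦ unit ]) (suc p) unit a λ x≢q → update-cong ω ones p unit a λ x≢p → ω≡1 x a x≢p x≢q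

shift-descent : ∀ {B} (f : ℕ → ℕ) {n} → (∀ e → e < B → shift (suc e) f n ≤ shift e f n) →
                ∀ e d → e + d ≤ B → shift (e + d) f n ≤ shift e f n
shift-descent f step e zero    le rewrite +-identityʳ e = ≤-refl
shift-descent f step e (suc d) le rewrite +-suc e d =
  ≤-trans (step (e + d) le) (shift-descent f step e d (<⇒≤ le))

-- The hypothesis on shifts says that x^e (1 - x) F has a nonnegative coefficient at n, for all
-- exponents e that occur when the sums for T p and T (p + 1) are compared term by term.
T-compare : ∀ {ε k p n} → 2 ≤ k → 1 ≤ p → suc p ≤ n →
  (∀ e → e < k * (p + suc p) → shift (suc e) (W k (omit₂ p) n) n ≤ shift e (W k (omit₂ p) n) n) →
  ε + shift (suc p) (W k (omit₂ p) n) n ≤ shift p (W k (omit₂ p) n) n →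
  ε + T k (suc p) n ≤ T k p n
T-compare {ε} {k} {p} {n} 2≤k 1≤p q≤n step gap = begin
  ε + T k q n
    ≡⟨ cong (ε +_) (W-extract₂ (ones [ q ↦ id ]) n 1≤k 1≤p q≤n λ x a _ x≢q → update-other ones q id a x≢q) ⟩
  ε + sumSquare k (λ a b → (ones [ q ↦ id ]) p a * ((ones [ q ↦ id ]) q b * X a b))
    ≡⟨ cong (ε +_) (square-cong λ a b → trans
         (cong₂ _*_ (update-other ones q id a (<⇒≢ ≤-refl)) (cong (_* X a b) (update-same ones q id b)))
         (*-identityˡ _)) ⟩
  ε + sumSquare k (λ a b → b * X a b)
    ≤⟨ rearrangement X 2≤k X-mono gap′ ⟩
  sumSquare k (λ a b → a * X a b)
    ≡⟨ square-cong (λ a b → trans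
         (cong₂ _*_ (update-same ones p id a) (cong (_* X a b) (update-other ones p id b 1+n≢n)))
         (cong (a *_) (*-identityˡ _))) ⟨
  sumSquare k (λ a b → (ones [ p ↦ id ]) p a * ((ones [ p ↦ id ]) q b * X a b))
    ≡⟨ W-extract₂ (ones [ p ↦ id ]) n 1≤k 1≤p q≤n (λ x a x≢p _ → update-other ones p id a x≢p) ⟨
  T k p n ∎
  where
  open ≤-Reasoning
  q = suc p
  F = W k (omit₂ p) n
  1≤k = ≤-trans (s≤s z≤n) 2≤k
  X : ℕ → ℕ → ℕ
  X a b = shift (a * p + b * q) F n
  square-cong : ∀ {f g : ℕ → ℕ → ℕ} → (∀ a b → f a b ≡ g a b) → sumSquare k f ≡ sumSquare k g
  square-cong eq = sumTo-cong k (λ a _ → sumTo-cong k (λ b _ → eq a b))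
  gap′ : ε + X 0 1 ≤ X 1 0
  gap′ rewrite +-identityʳ p | +-identityʳ p = gap
  X-mono : ∀ {a b} → b < a → a < k → X b a ≤ X a b
  X-mono {a} {b} b<a a<k with m≤n⇒∃[o]m+o≡n (<⇒≤ b<a)
  ... | d , refl = subst (λ z → shift z F n ≤ X (b + d) b) (sym (swap b d p))
    (shift-descent F step ((b + d) * p + b * q) d (≤-trans (≤-reflexive (sym (swap b d p)))
      (≤-trans (+-mono-≤ (*-monoˡ-≤ p (≤-trans (m≤m+n b d) (<⇒≤ a<k))) (*-monoˡ-≤ q (<⇒≤ a<k)))
               (≤-reflexive (sym (*-distribˡ-+ k p q))))))
    where
    swap : ∀ b d p → b * p + (b + d) * suc p ≡ (b + d) * p + b * suc p + d
    swap = solve-∀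

-- Chains o, k o, k² o, …

-- Inequalities ε + shift d f n ≤ f n are used throughout: the coefficient of (1 - x^d) f at n is
-- at least ε.

-- The part x is free to occur.
Full : Weights → ℕ → Set
Full ω x = ∀ a → ω x a ≡ 1

-- (1 - x^m) times a product containing [m] is (1 - x^(km)) times the product without [m].
factor-gap : ∀ {k ω m N n ε} → 1 ≤ k → 1 ≤ m → m ≤ N → Full ω m →
  ε + shift (k * m) (W k (ω [ m ↦ unit ]) N) n ≤ W k (ω [ m ↦ unit ]) N n →
  ε + shift m (W k ω N) n ≤ W k ω N n
factor-gap {k} {ω} {m} {N} {n} {ε} 1≤k 1≤m m≤N full gap = +-cancelʳ-≤ (shift (k * m) g n) _ _ (begin
  ε + shift m (W k ω N) n + shift (k * m) g n  ≡⟨ swap ε _ _ ⟩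
  ε + shift (k * m) g n + shift m (W k ω N) n  ≤⟨ +-monoˡ-≤ _ gap ⟩
  g n + shift m (W k ω N) n                    ≡⟨ cong (g n +_) (shift-cong m (λ j _ → W≡ j)) ⟩
  g n + shift m (factor k one m g) n           ≡⟨ factor-telescope k m g n ⟨
  factor k one m g n + shift (k * m) g n       ≡⟨ cong (_+ shift (k * m) g n) (W≡ n) ⟨
  W k ω N n + shift (k * m) g n                ∎)
  where
  open ≤-Reasoning
  g = W k (ω [ m ↦ unit ]) N
  W≡ : ∀ j → W k ω N j ≡ factor k one m g j
  W≡ j = trans (W-extract ω j 1≤k 1≤m m≤N) (factor-cong k {ω m} m full (λ _ _ → refl))
  swap : ∀ a b c → a + b + c ≡ a + c + b
  swap = solve-∀

next-link : ∀ k o j → k * o * k ^ j ≡ o * k ^ suc j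
next-link k o j = lemma k o (k ^ j)
  where
  lemma : ∀ k o x → k * o * x ≡ o * (k * x)
  lemma = solve-∀

link-increasing : ∀ {k o} → 2 ≤ k → 1 ≤ o → o < k * o
link-increasing {k} {suc o} 2≤k _ = m<n*m (suc o) k 2≤k
  where
  m<n*m : ∀ m k .{{_ : NonZero m}} → 2 ≤ k → m < k * m
  m<n*m m k 2≤k = <-≤-trans (m<m+n m (>-nonZero⁻¹ m)) (≤-trans (≤-reflexive (cong (m +_) (sym (+-identityʳ m)))) (*-monoˡ-≤ m 2≤k))

later-link : ∀ {k o} j → 2 ≤ k → 1 ≤ o → k * o * k ^ j ≢ o
later-link {k} {o} j 2≤k 1≤o eq = <⇒≢ (<-≤-trans (link-increasing 2≤k 1≤o) (m≤m*n (k * o) (k ^ j) {{m^n≢0 k j {{>-nonZero (≤-trans (s≤s z≤n) 2≤k)}}}})) (sym eq)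

≤-without : ∀ {ψ ω : Weights} {o} → (∀ x a → ψ x a ≤ ω x a) → (∀ a → ψ o a ≤ unit a) →
            ∀ x a → ψ x a ≤ (ω [ o ↦ unit ]) x a
≤-without {ψ} {ω} {o} ψ≤ω ψo x a with x ≟ o
... | yes refl = ≤-trans (ψo a) (≤-reflexive (sym (update-same ω x unit a)))
... | no  x≢o  = ≤-trans (ψ≤ω x a) (≤-reflexive (sym (update-other ω o unit a x≢o)))

-- If all parts o, k o, k² o, … are free, then (1 - x^o) W k ω N agrees up to degree N with the
-- product over the remaining parts, and therefore dominates W k ψ N for smaller weights ψ that
-- forbid the whole chain. The fuel bounds the number of links up to N.
chain-gap : ∀ fuel {k N ω ψ o n} → 2 ≤ k → 1 ≤ o → N < fuel + o → n ≤ N →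
  (∀ j → Full ω (o * k ^ j)) → (∀ x a → ψ x a ≤ ω x a) → (∀ j a → ψ (o * k ^ j) a ≤ unit a) →
  W k ψ N n + shift o (W k ω N) n ≤ W k ω N n
chain-gap fuel {k} {N} {ω} {ψ} {o} {n} 2≤k 1≤o enough n≤N full ψ≤ω avoids with o ≤? N
... | no o≰N = begin
  W k ψ N n + shift o (W k ω N) n ≡⟨ cong (W k ψ N n +_) (shift-beyond (W k ω N) (≤-<-trans n≤N (≰⇒> o≰N))) ⟩
  W k ψ N n + 0                   ≡⟨ +-identityʳ _ ⟩
  W k ψ N n                       ≤⟨ W-mono k N (λ x _ _ → ψ≤ω x) ⟩
  W k ω N n                       ∎
  where open ≤-Reasoning
chain-gap zero 2≤k 1≤o enough n≤N full ψ≤ω avoids | yes o≤N = contradiction o≤N (<⇒≱ enough)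
chain-gap (suc fuel) {k} {N} {ω} {ψ} {o} {n} 2≤k 1≤o enough n≤N full ψ≤ω avoids | yes o≤N =
  factor-gap (≤-trans (s≤s z≤n) 2≤k) 1≤o o≤N (subst (Full ω) (*-identityʳ o) (full 0))
    (chain-gap fuel 2≤k (≤-trans 1≤o (<⇒≤ o<ko))
      (≤-trans enough (≤-trans (≤-reflexive (sym (+-suc fuel o))) (+-monoʳ-≤ fuel o<ko))) n≤N
      (λ j a → trans (update-other ω o unit a (later-link j 2≤k 1≤o))
        (trans (cong (λ x → ω x a) (next-link k o j)) (full (suc j) a)))
      (≤-without ψ≤ω (λ a → subst (λ x → ψ x a ≤ unit a) (*-identityʳ o) (avoids 0 a)))
      (λ j a → subst (λ x → ψ x a ≤ unit a) (sym (next-link k o j)) (avoids (suc j) a)))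
  where
  o<ko = link-increasing 2≤k 1≤o

-- Forbids the parts o, k o, …, k^(i-1) o.
strip : ℕ → ℕ → ℕ → Weights → Weights
strip zero    k o ω = ω
strip (suc i) k o ω = strip i k (k * o) (ω [ o ↦ unit ])

strip-other : ∀ i {k o ω x} a → (∀ j → x ≢ o * k ^ j) → strip i k o ω x a ≡ ω x a
strip-other zero    a x≢ = refl
strip-other (suc i) {k} {o} {ω} {x} a x≢ = trans
  (strip-other i a (λ j eq → x≢ (suc j) (trans eq (next-link k o j))))
  (update-other ω o unit a (λ eq → x≢ 0 (trans eq (sym (*-identityʳ o)))))

≤-strip : ∀ i {k o} {ψ ω : Weights} → (∀ x a → ψ x a ≤ ω x a) → (∀ j a → ψ (o * k ^ j) a ≤ unit a) →
          ∀ x a → ψ x a ≤ strip i k o ω x a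
≤-strip zero    ψ≤ω avoids = ψ≤ω
≤-strip (suc i) {k} {o} {ψ} ψ≤ω avoids = ≤-strip i
  (≤-without ψ≤ω (λ a → subst (λ x → ψ x a ≤ unit a) (*-identityʳ o) (avoids 0 a)))
  (λ j a → subst (λ x → ψ x a ≤ unit a) (sym (next-link k o j)) (avoids (suc j) a))

-- A chain of which only the first i parts are used up.
strip-gap : ∀ i {k N ω o n ε} → 2 ≤ k → 1 ≤ o → o * k ^ i ≤ N → (∀ j → j < i → Full ω (o * k ^ j)) →
  ε + shift (o * k ^ i) (W k (strip i k o ω) N) n ≤ W k (strip i k o ω) N n →
  ε + shift o (W k ω N) n ≤ W k ω N n
strip-gap zero {k} {N} {ω} {o} {n} {ε} 2≤k 1≤o le full gap =
  subst (λ d → ε + shift d (W k ω N) n ≤ W k ω N n) (*-identityʳ o) gap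
strip-gap (suc i) {k} {N} {ω} {o} {n} {ε} 2≤k 1≤o le full gap =
  factor-gap (≤-trans (s≤s z≤n) 2≤k) 1≤o (≤-trans (m≤m*n o (k ^ suc i) {{m^n≢0 k (suc i) {{>-nonZero (≤-trans (s≤s z≤n) 2≤k)}}}}) le)
    (subst (Full ω) (*-identityʳ o) (full 0 (s≤s z≤n)))
    (strip-gap i 2≤k (≤-trans 1≤o (<⇒≤ (link-increasing 2≤k 1≤o))) (≤-trans (≤-reflexive (next-link k o i)) le)
      (λ j j<i a → trans (update-other ω o unit a (later-link j 2≤k 1≤o))
        (trans (cong (λ x → ω x a) (next-link k o j)) (full (suc j) (s≤s j<i) a)))
      (subst (λ d → ε + shift d (W k (strip (suc i) k o ω) N) n ≤ W k (strip (suc i) k o ω) N n)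
             (sym (next-link k o i)) gap))

-- Finite sums of elements of G.
data Span (G : ℕ → Set) : ℕ → Set where
  empty : Span G 0
  _∷_   : ∀ {o d} → G o → Span G d → Span G (o + d)

span-descent : ∀ {G N f} → (∀ {o} → G o → ∀ n → n ≤ N → shift o f n ≤ f n) →
               ∀ {d} → Span G d → ∀ n → n ≤ N → shift d f n ≤ f n
span-descent         G-descent empty            n n≤N = ≤-refl
span-descent {f = f} G-descent (_∷_ {o} {d} g s) n n≤N = begin
  shift (o + d) f n         ≡⟨ shift-shift o d f n ⟨
  shift o (shift d f) n     ≤⟨ shift-mono o (λ m m≤n → span-descent G-descent s m (≤-trans m≤n n≤N)) ⟩
  shift o f n               ≤⟨ G-descent g n n≤N ⟩
  f n                       ∎
  where open ≤-Reasoning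

-- 1 - x^(o+d) = (1 - x^o) + x^o (1 - x^d): the gap ε is gained at the first summand, and the others
-- do not lose anything.
span-gap : ∀ {G N f ε n} → (∀ {o} → G o → ∀ n → n ≤ N → shift o f n ≤ f n) →
           (∀ {o} → G o → ε + shift o f n ≤ f n) → n ≤ N →
           ∀ {d} → 1 ≤ d → Span G d → ε + shift d f n ≤ f n
span-gap {f = f} {ε} {n} G-descent G-gap n≤N 1≤d (_∷_ {o} {d} g s) = begin
  ε + shift (o + d) f n      ≡⟨ cong (ε +_) (shift-shift o d f n) ⟨
  ε + shift o (shift d f) n  ≤⟨ +-monoʳ-≤ ε (shift-mono o (λ m m≤n → span-descent G-descent s m (≤-trans m≤n n≤N))) ⟩
  ε + shift o f n            ≤⟨ G-gap g ⟩
  f n                        ∎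
  where open ≤-Reasoning

span-multiple : ∀ {G o} h → G o → Span G (h * o)
span-multiple zero    g = empty
span-multiple (suc h) g = g ∷ span-multiple h g

span₂₃ : ∀ {G} → G 2 → G 3 → ∀ n → Span G (2 + n)
span₂₃ g₂ g₃ zero          = g₂ ∷ empty
span₂₃ g₂ g₃ (suc zero)    = g₃ ∷ empty
span₂₃ g₂ g₃ (suc (suc n)) = g₂ ∷ span₂₃ g₂ g₃ n

span₂₅ : ∀ {G} → G 2 → G 5 → ∀ n → Span G (4 + n)
span₂₅ g₂ g₅ zero          = g₂ ∷ (g₂ ∷ empty)
span₂₅ g₂ g₅ (suc zero)    = g₅ ∷ empty
span₂₅ g₂ g₅ (suc (suc n)) = g₂ ∷ span₂₅ g₂ g₅ n

span₃₅ : ∀ {G} → G 3 → G 5 → ∀ n → Span G (8 + n)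
span₃₅ g₃ g₅ zero                = g₃ ∷ (g₅ ∷ empty)
span₃₅ g₃ g₅ (suc zero)          = g₃ ∷ (g₃ ∷ (g₃ ∷ empty))
span₃₅ g₃ g₅ (suc (suc zero))    = g₅ ∷ (g₅ ∷ empty)
span₃₅ g₃ g₅ (suc (suc (suc n))) = g₃ ∷ span₃₅ g₃ g₅ n

-- Conditions ensuring that the chain of o avoids the powers of k and P - 1, P, P + 1, for a power P
-- of k. The upper bound makes the chain avoid the parts used in the witnesses for strictness.
record Generator (k P o : ℕ) : Set where
  constructor generator
  field
    indivisible : ¬ k ∣ o
    lower       : 2 ≤ o
    upper       : o ≤ 10
    small       : 1 + o < P

-- For k = 2 the power is at least 8 and for k = 3 at least 9, the powers 2, 4 and 3 being excluded.
span-power : ∀ {k} i → 2 ≤ k → (k ≡ 2 → 5 ≤ k ^ suc i) → (k ≡ 3 → 4 ≤ k ^ suc i) →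
             Span (Generator k (k ^ suc i)) (k ^ suc i)
span-power {1} i (s≤s ()) _ _
span-power {2} zero _ big _ = contradiction (big refl) λ { (s≤s (s≤s ())) }
span-power {2} (suc zero) _ big _ = contradiction (big refl) λ { (s≤s (s≤s (s≤s (s≤s ())))) }
span-power {2} (suc (suc i)) _ _ _ = subst (λ P → Span (Generator 2 P) P) (m+[n∸m]≡n 8≤P)
  (span₃₅ (generator (λ d → contradiction (∣⇒≤ (∣m+n∣m⇒∣n d (divides 1 refl))) λ { (s≤s ()) }) (s≤s (s≤s z≤n)) (m≤m+n 3 7) (m≤m+n 5 _))
          (generator (λ d → contradiction (∣⇒≤ (∣m+n∣m⇒∣n d (divides 2 refl))) λ { (s≤s ()) }) (s≤s (s≤s z≤n)) (m≤m+n 5 5) (m≤m+n 7 _))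
          (2 ^ (3 + i) ∸ 8))
  where
  8≤P : 8 ≤ 2 ^ (3 + i)
  8≤P = ^-monoʳ-≤ 2 (m≤m+n 3 i)
span-power {3} zero _ _ big = contradiction (big refl) λ { (s≤s (s≤s (s≤s ()))) }
span-power {3} (suc i) _ _ _ = subst (λ P → Span (Generator 3 P) P) (m+[n∸m]≡n 9≤P)
  (span₂₅ (generator (>⇒∤ (s≤s (s≤s (s≤s z≤n)))) (s≤s (s≤s z≤n)) (m≤m+n 2 8) (m≤m+n 4 _))
          (generator (λ d → contradiction (∣⇒≤ (∣m+n∣m⇒∣n d (divides 1 refl))) λ { (s≤s (s≤s ())) }) (s≤s (s≤s z≤n)) (m≤m+n 5 5) (m≤m+n 7 _))
          (5 + (3 ^ (2 + i) ∸ 9)))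
  where
  9≤P : 9 ≤ 3 ^ (2 + i)
  9≤P = ^-monoʳ-≤ 3 (m≤m+n 2 i)
span-power {4} i _ _ _ = subst (Span (Generator 4 (4 ^ suc i))) (lemma (4 ^ i))
  (span-multiple (2 * 4 ^ i) (generator (>⇒∤ (s≤s (s≤s (s≤s z≤n)))) (s≤s (s≤s z≤n)) (m≤m+n 2 8) (^-monoʳ-≤ 4 (m≤m+n 1 i))))
  where
  lemma : ∀ x → 2 * x * 2 ≡ 4 * x
  lemma = solve-∀
span-power {k@(suc (suc (suc (suc (suc l)))))} i _ _ _ = subst (λ P → Span (Generator k P) P) (m+[n∸m]≡n 5≤P)
  (span₂₃ (generator (>⇒∤ (s≤s (s≤s (s≤s z≤n)))) (s≤s (s≤s z≤n)) (m≤m+n 2 8) (m≤m+n 4 _))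
          (generator (>⇒∤ (s≤s (s≤s (s≤s (s≤s z≤n))))) (s≤s (s≤s z≤n)) (m≤m+n 3 7) (m≤m+n 5 _))
          (3 + (k ^ suc i ∸ 5)))
  where
  5≤P : 5 ≤ k ^ suc i
  5≤P = ≤-trans (m≤m+n 5 l) (m≤m*n k (k ^ i) {{m^n≢0 k i}})

link-not-power : ∀ {k o} → 2 ≤ k → 2 ≤ o → ¬ k ∣ o → ∀ j l → o * k ^ j ≢ 1 * k ^ l
link-not-power {k} {o} 2≤k 2≤o k∤o j l eq = go j l (trans eq (*-identityˡ (k ^ l)))
  where
  go : ∀ j l → o * k ^ j ≢ k ^ l
  go zero    zero    eq = contradiction (trans (sym (*-identityʳ o)) eq) (>⇒≢ 2≤o)
  go zero    (suc l) eq = k∤o (subst (k ∣_) (trans (sym eq) (*-identityʳ o)) (m∣m*n (k ^ l)))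
  go (suc j) zero    eq = contradiction (∣1⇒≡1 (subst (k ∣_) eq (∣n⇒∣m*n o (m∣m*n (k ^ j))))) (>⇒≢ 2≤k)
  go (suc j) (suc l) eq = go j l (*-cancelˡ-≡ (o * k ^ j) (k ^ l) k {{>-nonZero (≤-trans (s≤s z≤n) 2≤k)}} (trans (lemma k o (k ^ j)) eq))
    where
    lemma : ∀ k o x → k * (o * x) ≡ o * (k * x)
    lemma = solve-∀

-- A later link k^(j+1) o is divisible by k, as P is, so it cannot be adjacent to P.
link-not-neighbour : ∀ {k P o} → 2 ≤ k → k ∣ P → Generator k P o → ∀ j → o * k ^ j ≢ suc P × suc (o * k ^ j) ≢ P
link-not-neighbour {k} {P} {o} 2≤k k∣P gen zero rewrite *-identityʳ o =
  <⇒≢ (<-trans (<-trans ≤-refl (Generator.small gen)) ≤-refl) , <⇒≢ (Generator.small gen)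
link-not-neighbour {k} {P} {o} 2≤k k∣P gen (suc j) =
  (λ eq → k∤1 (∣m+n∣m⇒∣n {m = P} (subst (k ∣_) (trans eq (+-comm 1 P)) k∣link) k∣P)) ,
  (λ eq → k∤1 (∣m+n∣m⇒∣n {m = o * k ^ suc j} (subst (k ∣_) (trans (sym eq) (+-comm 1 _)) k∣P) k∣link))
  where
  k∣link : k ∣ o * k ^ suc j
  k∣link = ∣n⇒∣m*n o (m∣m*n (k ^ j))
  k∤1 : ¬ k ∣ 1
  k∤1 d = contradiction (∣1⇒≡1 d) (>⇒≢ 2≤k)

omit₂-full : ∀ {p x} → x ≢ p → x ≢ suc p → Full (omit₂ p) x
omit₂-full {p} {x} x≢p x≢q a = trans (update-other (ones [ p ↦ unit ]) (suc p) unit a x≢q) (update-other ones p unit a x≢p)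

generator-full : ∀ {k p o} i → 2 ≤ k → k ^ suc i ≡ p ⊎ k ^ suc i ≡ suc p → Generator k (k ^ suc i) o →
                 ∀ j → Full (strip (suc i) k 1 (omit₂ p)) (o * k ^ j)
generator-full {k} {p} {o} i 2≤k P≡ gen j a = trans
  (strip-other (suc i) a (λ l → not-power j l))
  (omit₂-full (≢p P≡) (≢q P≡) a)
  where
  not-power = link-not-power 2≤k (Generator.lower gen) (Generator.indivisible gen)
  ≢P : o * k ^ j ≢ k ^ suc i
  ≢P eq = not-power j (suc i) (trans eq (sym (*-identityˡ _)))
  ≢±1 = link-not-neighbour 2≤k (m∣m*n (k ^ i)) gen j
  ≢p : k ^ suc i ≡ p ⊎ k ^ suc i ≡ suc p → o * k ^ j ≢ p
  ≢p (inj₁ P≡p) eq = ≢P (trans eq (sym P≡p))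
  ≢p (inj₂ P≡q) eq = proj₂ ≢±1 (trans (cong suc eq) (sym P≡q))
  ≢q : k ^ suc i ≡ p ⊎ k ^ suc i ≡ suc p → o * k ^ j ≢ suc p
  ≢q (inj₁ P≡p) eq = proj₁ ≢±1 (trans eq (cong suc (sym P≡p)))
  ≢q (inj₂ P≡q) eq = ≢P (trans eq (sym P≡q))

-- Weights that are at most 1, forbid p and p + 1, and permit only parts that are at least 11 and not
-- divisible by k. No chain starting at some o ≤ 10 contains such a part.
record Sparse (k p : ℕ) (ψ : Weights) : Set where
  field
    support : ∀ x → (11 ≤ x × ¬ k ∣ x) ⊎ (∀ a → ψ x a ≤ unit a)
    ≤1      : ∀ x a → ψ x a ≤ 1
    omit-p  : ∀ a → ψ p a ≤ unit a
    omit-q  : ∀ a → ψ (suc p) a ≤ unit a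

sparse-avoids : ∀ {k p ψ o} → 2 ≤ k → o ≤ 10 → Sparse k p ψ → ∀ j a → ψ (o * k ^ j) a ≤ unit a
sparse-avoids {k} {o = o} 2≤k o≤10 sparse j a with Sparse.support sparse (o * k ^ j)
... | inj₂ light = light a
... | inj₁ (11≤x , k∤x) = contradiction 11≤x (<⇒≱ (s≤s (x≤10 j k∤x)))
  where
  x≤10 : ∀ j → ¬ k ∣ o * k ^ j → o * k ^ j ≤ 10
  x≤10 zero    _   = ≤-trans (≤-reflexive (*-identityʳ o)) o≤10
  x≤10 (suc j) k∤x = contradiction (∣n⇒∣m*n o (m∣m*n (k ^ j))) k∤x

sparse≤omit₂ : ∀ {k p ψ} → Sparse k p ψ → ∀ x a → ψ x a ≤ omit₂ p x a
sparse≤omit₂ sparse = ≤-without (≤-without (Sparse.≤1 sparse) (Sparse.omit-p sparse)) (Sparse.omit-q sparse)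

-- All parts are forbidden, so that the weak inequalities are the case ψ = no-weight.
no-weight : Weights
no-weight _ = unit

no-weight-sparse : ∀ {k p} → Sparse k p no-weight
no-weight-sparse = record { support = λ _ → inj₂ (λ _ → ≤-refl) ; ≤1 = λ _ → unit≤1 ; omit-p = λ _ → ≤-refl ; omit-q = λ _ → ≤-refl }
  where
  unit≤1 : ∀ a → unit a ≤ 1
  unit≤1 zero    = ≤-refl
  unit≤1 (suc a) = z≤n

-- The chain of 1 consists of the powers of k.
descent-intact : ∀ {k p ψ N n} → 2 ≤ k → Sparse k p ψ → (∀ i → k ^ i ≢ p) → (∀ i → k ^ i ≢ suc p) → n ≤ N →
  W k ψ N n + shift 1 (W k (omit₂ p) N) n ≤ W k (omit₂ p) N n
descent-intact {k} {N = N} 2≤k sparse ≢p ≢q n≤N = chain-gap N 2≤k ≤-refl (≤-reflexive (+-comm 1 N)) n≤N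
  (λ j → omit₂-full (λ eq → ≢p j (trans (sym (*-identityˡ _)) eq)) (λ eq → ≢q j (trans (sym (*-identityˡ _)) eq)))
  (sparse≤omit₂ sparse) (sparse-avoids 2≤k (s≤s z≤n) sparse)

-- The chain of 1 is cut off at the power k^(i+1), which is p or p + 1.
descent-broken : ∀ {k p ψ N n} i → 2 ≤ k → Sparse k p ψ → 2 ≤ p → suc p ≤ N →
  k ^ suc i ≡ p ⊎ k ^ suc i ≡ suc p → Span (Generator k (k ^ suc i)) (k ^ suc i) → n ≤ N →
  W k ψ N n + shift 1 (W k (omit₂ p) N) n ≤ W k (omit₂ p) N n
descent-broken {k} {p} {ψ} {N} {n} i 2≤k sparse 2≤p q≤N P≡ span n≤N =
  strip-gap (suc i) 2≤k ≤-refl (≤-trans (≤-reflexive (*-identityˡ _)) (P≤N P≡)) below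
    (subst (λ d → W k ψ N n + shift d g n ≤ g n) (sym (*-identityˡ (k ^ suc i)))
      (span-gap (λ gen n n≤N → ≤-trans (m≤n+m _ (W k no-weight N n)) (gap no-weight-sparse gen n≤N)) (λ gen → gap sparse gen n≤N) n≤N
        (m^n>0 k {{>-nonZero (≤-trans (s≤s z≤n) 2≤k)}} (suc i)) span))
  where
  g = W k (strip (suc i) k 1 (omit₂ p)) N
  gap : ∀ {ψ o n} → Sparse k p ψ → Generator k (k ^ suc i) o → n ≤ N → W k ψ N n + shift o g n ≤ g n
  gap {o = o} sparse gen n≤N = chain-gap N 2≤k (≤-trans (s≤s z≤n) (Generator.lower gen))
    (m<m+n N (≤-trans (s≤s z≤n) (Generator.lower gen))) n≤N
    (generator-full i 2≤k P≡ gen)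
    (≤-strip (suc i) (sparse≤omit₂ sparse) (sparse-avoids 2≤k (s≤s z≤n) sparse))
    (sparse-avoids 2≤k (Generator.upper gen) sparse)
  P≤N : k ^ suc i ≡ p ⊎ k ^ suc i ≡ suc p → k ^ suc i ≤ N
  P≤N (inj₁ eq) = ≤-trans (≤-reflexive eq) (<⇒≤ q≤N)
  P≤N (inj₂ eq) = ≤-trans (≤-reflexive eq) q≤N
  below : ∀ j → j < suc i → Full (omit₂ p) (1 * k ^ j)
  below j j<i = subst (Full (omit₂ p)) (sym (*-identityˡ (k ^ j))) (omit₂-full (≢p P≡) (≢q P≡))
    where
    k^j<P : k ^ j < k ^ suc i
    k^j<P = ^-monoʳ-< k 2≤k j<i
    ≢p : k ^ suc i ≡ p ⊎ k ^ suc i ≡ suc p → k ^ j ≢ p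
    ≢p (inj₁ P≡p) eq = <⇒≢ k^j<P (trans eq (sym P≡p))
    ≢p (inj₂ P≡q) eq = consecutive j eq (trans P≡q (cong suc (sym eq)))
      where
      -- Powers of k can only be consecutive if the smaller one is 1, but p > 1.
      consecutive : ∀ j → k ^ j ≡ p → k ^ suc i ≢ suc (k ^ j)
      consecutive zero    1≡p _  = contradiction 1≡p (<⇒≢ 2≤p)
      consecutive (suc j) _   eq = contradiction
        (∣1⇒≡1 (∣m+n∣m⇒∣n {m = k ^ suc j} (subst (k ∣_) (trans eq (+-comm 1 _)) (m∣m*n (k ^ i))) (m∣m*n (k ^ j))))
        (>⇒≢ 2≤k)
    ≢q : k ^ suc i ≡ p ⊎ k ^ suc i ≡ suc p → k ^ j ≢ suc p
    ≢q (inj₁ P≡p) eq = <⇒≱ k^j<P (≤-trans (≤-reflexive P≡p) (≤-trans (n≤1+n p) (≤-reflexive (sym eq))))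
    ≢q (inj₂ P≡q) eq = <⇒≢ k^j<P (trans eq (sym P≡q))

power? : ∀ {k} x → 2 ≤ k → Dec (∃ λ i → k ^ i ≡ x)
power? {k} x 2≤k = map′ (λ (i , _ , eq) → i , eq) (λ (i , eq) → i , subst (i <_) eq (n<k^n i) , eq)
  (anyUpTo? (λ i → k ^ i ≟ x) x)
  where
  n<k^n : ∀ n → n < k ^ n
  n<k^n zero    = s≤s z≤n
  n<k^n (suc n) = ≤-<-trans (n<k^n n) (^-monoʳ-< k 2≤k (n<1+n n))

-- The pairs (k, p) for which the chain argument applies.
record Generic (k p : ℕ) : Set where
  field
    p≥2 : 2 ≤ p
    k≡2 : k ≡ 2 → 5 ≤ p
    k≡3 : k ≡ 3 → 4 ≤ p

-- (1 - x) F has nonnegative coefficients, and dominates the series of any sparse weights.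
descent : ∀ {k p ψ N n} → 2 ≤ k → Generic k p → Sparse k p ψ → suc p ≤ N → n ≤ N →
  W k ψ N n + shift 1 (W k (omit₂ p) N) n ≤ W k (omit₂ p) N n
descent {k} {p} {ψ} {N} {n} 2≤k generic sparse q≤N n≤N with power? p 2≤k | power? (suc p) 2≤k
... | no ≢p | no ≢q = descent-intact 2≤k sparse (λ i eq → ≢p (i , eq)) (λ i eq → ≢q (i , eq)) n≤N
... | yes (zero , 1≡p) | _ = contradiction 1≡p (<⇒≢ (Generic.p≥2 generic))
... | yes (suc i , eq) | _ = descent-broken i 2≤k sparse (Generic.p≥2 generic) q≤N (inj₁ eq)
  (span-power i 2≤k (λ k≡2 → ≤-trans (Generic.k≡2 generic k≡2) (≤-reflexive (sym eq)))
                    (λ k≡3 → ≤-trans (Generic.k≡3 generic k≡3) (≤-reflexive (sym eq)))) n≤N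
... | no _ | yes (zero , 1≡q) = contradiction (suc-injective 1≡q) (<⇒≢ (≤-trans (s≤s z≤n) (Generic.p≥2 generic)))
... | no _ | yes (suc i , eq) = descent-broken i 2≤k sparse (Generic.p≥2 generic) q≤N (inj₂ eq)
  (span-power i 2≤k (λ k≡2 → ≤-trans (Generic.k≡2 generic k≡2) (≤-trans (n≤1+n p) (≤-reflexive (sym eq))))
                    (λ k≡3 → ≤-trans (Generic.k≡3 generic k≡3) (≤-trans (n≤1+n p) (≤-reflexive (sym eq))))) n≤N

-- Strictness from partitions into one or two large parts

sumTo-extend : ∀ {k l} (g : ℕ → ℕ) → k ≤ l → sumTo k g ≤ sumTo l g
sumTo-extend {k} g k≤l = go (≤⇒≤′ k≤l)
  where
  go : ∀ {l} → k ≤′ l → sumTo k g ≤ sumTo l g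
  go (≤′-reflexive refl) = ≤-refl
  go (≤′-step k≤l)       = ≤-trans (go k≤l) (m≤m+n _ (g _))

sumTo-term : ∀ {k a} (g : ℕ → ℕ) → a < k → g a ≤ sumTo k g
sumTo-term {a = a} g a<k = ≤-trans (m≤n+m (g a) (sumTo a g)) (sumTo-extend g a<k)

W-widen : ∀ {k ω M N} n → 1 ≤ k → (∀ x → 1 ≤ ω x 0) → M ≤ N → W k ω M n ≤ W k ω N n
W-widen {k} {ω} {M} n 1≤k ω0 M≤N = go (≤⇒≤′ M≤N)
  where
  go : ∀ {N} → M ≤′ N → W k ω M n ≤ W k ω N n
  go (≤′-reflexive refl) = ≤-refl
  go (≤′-step {N} M≤N) = ≤-trans (go M≤N) (≤-trans (m≤n*m (W k ω N n) (ω (suc N) 0) {{>-nonZero (ω0 (suc N))}})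
    (sumTo-term (λ a → ω (suc N) a * shift (a * suc N) (W k ω N) n) 1≤k))

W-add-part : ∀ {k ω N} n → 2 ≤ k → 1 ≤ ω (suc N) 1 → W k ω N n ≤ W k ω (suc N) (suc N + n)
W-add-part {k} {ω} {N} n 2≤k ω1 = begin
  W k ω N n
    ≤⟨ m≤n*m (W k ω N n) (ω (suc N) 1) {{>-nonZero ω1}} ⟩
  ω (suc N) 1 * W k ω N n
    ≡⟨ cong (ω (suc N) 1 *_) (trans (cong (λ d → shift d (W k ω N) (suc N + n)) (*-identityˡ (suc N))) (shift-exact (suc N) (W k ω N) n)) ⟨
  ω (suc N) 1 * shift (1 * suc N) (W k ω N) (suc N + n)
    ≤⟨ sumTo-term (λ a → ω (suc N) a * shift (a * suc N) (W k ω N) (suc N + n)) 2≤k ⟩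
  W k ω (suc N) (suc N + n) ∎
  where open ≤-Reasoning

W-empty : ∀ {k ω} N → 1 ≤ k → (∀ x → 1 ≤ ω x 0) → 1 ≤ W k ω N 0
W-empty N 1≤k ω0 = W-widen 0 1≤k ω0 (z≤n {N})

W-single : ∀ {k ω m N} → 2 ≤ k → (∀ x → 1 ≤ ω x 0) → 1 ≤ m → m ≤ N → 1 ≤ ω m 1 → 1 ≤ W k ω N m
W-single {k} {ω} {suc m} {N} 2≤k ω0 _ m≤N ωm = begin
  1                            ≤⟨ W-empty {k} {ω} m 1≤k ω0 ⟩
  W k ω m 0                    ≤⟨ W-add-part {k} {ω} {m} 0 2≤k ωm ⟩
  W k ω (suc m) (suc m + 0)    ≤⟨ W-widen (suc m + 0) 1≤k ω0 m≤N ⟩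
  W k ω N (suc m + 0)          ≡⟨ cong (W k ω N) (+-identityʳ (suc m)) ⟩
  W k ω N (suc m)              ∎
  where
  open ≤-Reasoning
  1≤k = ≤-trans (s≤s z≤n) 2≤k

W-pair : ∀ {k ω l m N} → 2 ≤ k → (∀ x → 1 ≤ ω x 0) → 1 ≤ l → l < m → m ≤ N → 1 ≤ ω l 1 → 1 ≤ ω m 1 → 1 ≤ W k ω N (m + l)
W-pair {k} {ω} {l} {suc m} {N} 2≤k ω0 1≤l (s≤s l≤m) m≤N ωl ωm = begin
  1                            ≤⟨ W-single {k} {ω} 2≤k ω0 1≤l l≤m ωl ⟩
  W k ω m l                    ≤⟨ W-add-part {k} {ω} {m} l 2≤k ωm ⟩
  W k ω (suc m) (suc m + l)    ≤⟨ W-widen (suc m + l) (≤-trans (s≤s z≤n) 2≤k) ω0 m≤N ⟩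
  W k ω N (suc m + l)          ∎
  where open ≤-Reasoning

sparse-add : ∀ {k p ψ x} → Sparse k p ψ → p ≤ 9 → 11 ≤ x → ¬ k ∣ x → Sparse k p (ψ [ x ↦ one ])
sparse-add {k} {p} {ψ} {x} sparse p≤9 11≤x k∤x = record
  { support = support
  ; ≤1      = ≤1
  ; omit-p  = λ a → ≤-trans (≤-reflexive (update-other ψ x one a (<⇒≢ (≤-trans (s≤s p≤9) (<⇒≤ 11≤x))))) (Sparse.omit-p sparse a)
  ; omit-q  = λ a → ≤-trans (≤-reflexive (update-other ψ x one a (<⇒≢ (≤-trans (s≤s (s≤s p≤9)) 11≤x)))) (Sparse.omit-q sparse a)
  }
  where
  support : ∀ y → (11 ≤ y × ¬ k ∣ y) ⊎ (∀ a → (ψ [ x ↦ one ]) y a ≤ unit a)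
  support y with y ≟ x
  ... | yes refl = inj₁ (11≤x , k∤x)
  ... | no  y≢x with Sparse.support sparse y
  ...   | inj₁ large = inj₁ large
  ...   | inj₂ light = inj₂ λ a → ≤-trans (≤-reflexive (update-other ψ x one a y≢x)) (light a)
  ≤1 : ∀ y a → (ψ [ x ↦ one ]) y a ≤ 1
  ≤1 y a with y ≟ x
  ... | yes refl = ≤-reflexive (update-same ψ x one a)
  ... | no  y≢x  = ≤-trans (≤-reflexive (update-other ψ x one a y≢x)) (Sparse.≤1 sparse y a)

update-one≥1 : ∀ {ψ} x {y} a → 1 ≤ ψ y a → 1 ≤ (ψ [ x ↦ one ]) y a
update-one≥1 {ψ} x {y} a ψ≥1 with y ≟ x
... | yes refl = ≤-reflexive (sym (update-same ψ x one a))
... | no  y≢x  = ≤-trans ψ≥1 (≤-reflexive (sym (update-other ψ x one a y≢x)))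

11-indivisible : ∀ {k} → 2 ≤ k → k ≤ 10 → ¬ k ∣ 11
11-indivisible 2≤k k≤10 = from-yes (allUpTo? (λ k → 2 ≤? k →-dec ¬? (k ∣? 11)) 11) (s≤s k≤10) 2≤k

witness₁ : ∀ {k p m N} → 2 ≤ k → p ≤ 9 → 11 ≤ m → ¬ k ∣ m → m ≤ N → ∃ λ ψ → Sparse k p ψ × 1 ≤ W k ψ N m
witness₁ {k} {p} {m} {N} 2≤k p≤9 11≤m k∤m m≤N = ψ , sparse-add no-weight-sparse p≤9 11≤m k∤m ,
  W-single {k} {ψ} 2≤k (λ x → update-one≥1 {no-weight} m {x} 0 ≤-refl) (≤-trans (s≤s z≤n) 11≤m) m≤N
    (≤-reflexive (sym (update-same no-weight m one 1)))
  where
  ψ = no-weight [ m ↦ one ]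

witness₂ : ∀ {k p l m N} → 2 ≤ k → p ≤ 9 → 11 ≤ l → l < m → ¬ k ∣ l → ¬ k ∣ m → m ≤ N →
           ∃ λ ψ → Sparse k p ψ × 1 ≤ W k ψ N (m + l)
witness₂ {k} {p} {l} {m} {N} 2≤k p≤9 11≤l l<m k∤l k∤m m≤N =
  ψ , sparse-add (sparse-add no-weight-sparse p≤9 11≤l k∤l) p≤9 (≤-trans 11≤l (<⇒≤ l<m)) k∤m ,
  W-pair {k} {ψ} {l} {m} 2≤k (λ x → update-one≥1 {χ} m {x} 0 (update-one≥1 {no-weight} l {x} 0 ≤-refl))
    (≤-trans (s≤s z≤n) 11≤l) l<m m≤N
    (update-one≥1 {χ} m {l} 1 (≤-reflexive (sym (update-same no-weight l one 1))))
    (≤-reflexive (sym (update-same χ m one 1)))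
  where
  χ = no-weight [ l ↦ one ]
  ψ = χ [ m ↦ one ]

-- If k divides m, then m - 11 and 11 are not divisible by k.
witness : ∀ {k p m N} → 2 ≤ k → k ≤ 10 → p ≤ 9 → 23 ≤ m → m ≤ N → ∃ λ ψ → Sparse k p ψ × 1 ≤ W k ψ N m
witness {k} {p} {m} {N} 2≤k k≤10 p≤9 23≤m m≤N with k ∣? m
... | no k∤m  = witness₁ 2≤k p≤9 (≤-trans (m≤m+n 11 12) 23≤m) k∤m m≤N
... | yes k∣m = subst (λ z → ∃ λ ψ → Sparse k p ψ × 1 ≤ W k ψ N z) l+11≡m
  (witness₂ {l = 11} {m = m ∸ 11} 2≤k p≤9 ≤-refl (∸-monoˡ-≤ 11 23≤m) k∤11 k∤l (≤-trans (m∸n≤m m 11) m≤N))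
  where
  k∤11 = 11-indivisible 2≤k k≤10
  l+11≡m : m ∸ 11 + 11 ≡ m
  l+11≡m = m∸n+n≡m (≤-trans (m≤m+n 11 12) 23≤m)
  k∤l : ¬ k ∣ m ∸ 11
  k∤l k∣l = k∤11 (∣m+n∣m⇒∣n (subst (k ∣_) (sym l+11≡m) k∣m) k∣l)

generic-step : ∀ {k p n} → 2 ≤ k → Generic k p → suc p ≤ n →
  ∀ e → shift (suc e) (W k (omit₂ p) n) n ≤ shift e (W k (omit₂ p) n) n
generic-step {k} {p} {n} 2≤k generic q≤n e = begin
  shift (suc e) F n      ≡⟨ cong (λ d → shift d F n) (+-comm 1 e) ⟩
  shift (e + 1) F n      ≡⟨ shift-shift e 1 F n ⟨
  shift e (shift 1 F) n  ≤⟨ shift-mono e (λ m m≤n → ≤-trans (m≤n+m _ (W k no-weight n m)) (descent 2≤k generic no-weight-sparse q≤n m≤n)) ⟩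
  shift e F n            ∎
  where
  open ≤-Reasoning
  F = W k (omit₂ p) n

generic-antitone : ∀ {k p n} → 2 ≤ k → Generic k p → suc p ≤ n → T k (suc p) n ≤ T k p n
generic-antitone {p = p} 2≤k generic q≤n = T-compare {0} 2≤k (≤-trans (s≤s z≤n) (Generic.p≥2 generic)) q≤n
  (λ e _ → generic-step 2≤k generic q≤n e) (generic-step 2≤k generic q≤n p)

generic-decreasing : ∀ {k p n} → 2 ≤ k → k ≤ 10 → p ≤ 9 → Generic k p → 32 ≤ n → T k (suc p) n < T k p n
generic-decreasing {k} {p} {n} 2≤k k≤10 p≤9 generic 32≤n
  with m≤n⇒∃[o]m+o≡n (≤-trans p≤9 (≤-trans (m≤m+n 9 23) 32≤n))
... | m , refl with witness {k} {p} {m} 2≤k k≤10 p≤9 (+-cancelˡ-≤ 9 23 m (≤-trans 32≤n (+-monoˡ-≤ m p≤9))) (m≤n+m m p)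
...   | ψ , sparse , positive = T-compare {1} 2≤k (≤-trans (s≤s z≤n) (Generic.p≥2 generic)) q≤n
  (λ e _ → generic-step 2≤k generic q≤n e) (begin
  1 + shift (suc p) F (p + m)      ≡⟨ cong (λ d → 1 + shift d F (p + m)) (+-comm 1 p) ⟩
  1 + shift (p + 1) F (p + m)      ≡⟨ cong suc (shift-shift p 1 F (p + m)) ⟨
  1 + shift p (shift 1 F) (p + m)  ≡⟨ cong suc (shift-exact p (shift 1 F) m) ⟩
  1 + shift 1 F m                  ≤⟨ +-monoˡ-≤ (shift 1 F m) positive ⟩
  W k ψ (p + m) m + shift 1 F m    ≤⟨ descent 2≤k generic sparse q≤n (m≤n+m m p) ⟩
  F m                              ≡⟨ shift-exact p F m ⟨
  shift p F (p + m)                ∎)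
  where
  open ≤-Reasoning
  F = W k (omit₂ p) (p + m)
  q≤n = ≤-trans (s≤s p≤9) (≤-trans (m≤m+n 10 22) 32≤n)

-- Enlarging the largest part

factor-two : ∀ {k} m f n → 2 ≤ k → f n + shift m f n ≤ factor k one m f n
factor-two m f n 2≤k = ≤-trans (≤-reflexive (lemma m)) (sumTo-extend (λ a → 1 * shift (a * m) f n) 2≤k)
  where
  lemma : ∀ m → f n + shift m f n ≡ f n + 0 + (shift (m + 0) f n + 0)
  lemma m rewrite +-identityʳ m | +-identityʳ (f n) | +-identityʳ (shift m f n) = refl

factor-three : ∀ {k} m f n → 3 ≤ k → f n + shift m f n + shift (2 * m) f n ≤ factor k one m f n
factor-three m f n 3≤k = ≤-trans (+-mono-≤ (factor-two m f n ≤-refl) (≤-reflexive (sym (*-identityˡ _))))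
                                 (sumTo-extend (λ a → 1 * shift (a * m) f n) 3≤k)

-- Enlarging a largest part, by induction on its size: partitions of n with largest part at most
-- x + 1 are sent to partitions of n + 1 with largest part at most x + 2. The shifted term counts the
-- partitions of n + 1 with largest parts x + 2 and x + 1, the latter k - 1 times.
grow-step : ∀ {k ω x n ε} → 2 ≤ k → Full ω (suc x) → Full ω (2 + x) →
  ε + W k ω x n ≤ W k ω (suc x) (suc n) →
  ε + shift (k * suc x) (W k ω x) n + W k ω (suc x) n ≤ W k ω (2 + x) (suc n)
grow-step {k} {ω} {x} {n} {ε} 2≤k full full′ gap = begin
  ε + shift (k * suc x) f n + A n
    ≡⟨ cong (ε + shift (k * suc x) f n +_) (A≡ n) ⟩
  ε + shift (k * suc x) f n + factor k one (suc x) f n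
    ≡⟨ regroup ε _ _ ⟩
  ε + (factor k one (suc x) f n + shift (k * suc x) f n)
    ≡⟨ cong (ε +_) (factor-telescope k (suc x) f n) ⟩
  ε + (f n + shift (suc x) (factor k one (suc x) f) n)
    ≡⟨ cong (λ z → ε + (f n + z)) (shift-cong (suc x) {n = n} (λ j _ → A≡ j)) ⟨
  ε + (f n + shift (suc x) A n)
    ≡⟨ +-assoc ε (f n) _ ⟨
  ε + f n + shift (2 + x) A (suc n)
    ≤⟨ +-monoˡ-≤ _ gap ⟩
  A (suc n) + shift (2 + x) A (suc n)
    ≤⟨ factor-two (2 + x) A (suc n) 2≤k ⟩
  factor k one (2 + x) A (suc n)
    ≡⟨ factor-cong k {ω (2 + x)} {one} (2 + x) full′ (λ _ _ → refl) ⟨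
  W k ω (2 + x) (suc n) ∎
  where
  open ≤-Reasoning
  f = W k ω x
  A = W k ω (suc x)
  A≡ : ∀ j → A j ≡ factor k one (suc x) f j
  A≡ j = factor-cong k {ω (suc x)} {one} (suc x) full (λ _ _ → refl)
  regroup : ∀ a b c → a + b + c ≡ a + (c + b)
  regroup = solve-∀

-- For k ≥ 3, partitions of n + 1 containing x + 2 twice are not reached.
grow-step₃ : ∀ {k ω x n} → 3 ≤ k → Full ω (suc x) → Full ω (2 + x) →
  W k ω x n ≤ W k ω (suc x) (suc n) →
  shift (2 * (2 + x)) (W k ω (suc x)) (suc n) + W k ω (suc x) n ≤ W k ω (2 + x) (suc n)
grow-step₃ {k} {ω} {x} {n} 3≤k full full′ gap = begin
  shift (2 * (2 + x)) A (suc n) + A n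
    ≤⟨ +-monoʳ-≤ (shift (2 * (2 + x)) A (suc n)) A≤ ⟩
  shift (2 * (2 + x)) A (suc n) + (A (suc n) + shift (2 + x) A (suc n))
    ≡⟨ +-comm (shift (2 * (2 + x)) A (suc n)) _ ⟩
  A (suc n) + shift (2 + x) A (suc n) + shift (2 * (2 + x)) A (suc n)
    ≤⟨ factor-three (2 + x) A (suc n) 3≤k ⟩
  factor k one (2 + x) A (suc n)
    ≡⟨ factor-cong k {ω (2 + x)} {one} (2 + x) full′ (λ _ _ → refl) ⟨
  W k ω (2 + x) (suc n) ∎
  where
  open ≤-Reasoning
  f = W k ω x
  A = W k ω (suc x)
  A≡ : ∀ j → A j ≡ factor k one (suc x) f j
  A≡ j = factor-cong k {ω (suc x)} {one} (suc x) full (λ _ _ → refl)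
  A≤ : A n ≤ A (suc n) + shift (2 + x) A (suc n)
  A≤ = begin
    A n                                                  ≡⟨ A≡ n ⟩
    factor k one (suc x) f n                             ≤⟨ m≤m+n _ _ ⟩
    factor k one (suc x) f n + shift (k * suc x) f n     ≡⟨ factor-telescope k (suc x) f n ⟩
    f n + shift (suc x) (factor k one (suc x) f) n       ≡⟨ cong (f n +_) (shift-cong (suc x) {n = n} (λ j _ → A≡ j)) ⟨
    f n + shift (suc x) A n                              ≤⟨ +-monoˡ-≤ _ gap ⟩
    A (suc n) + shift (2 + x) A (suc n)                  ∎

-- Once every part beyond L is free, an excess ε at M persists for all larger bounds N.
grow : ∀ {k ω L M N n ε} → 2 ≤ k → (∀ x → L < x → Full ω x) → L ≤ M → M ≤ N →
  ε + W k ω M n ≤ W k ω (suc M) (suc n) → ε + W k ω N n ≤ W k ω (suc N) (suc n)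
grow {k} {ω} {L} {M} {n = n} {ε} 2≤k full L≤M M≤N gap = go (≤⇒≤′ M≤N)
  where
  go : ∀ {N} → M ≤′ N → ε + W k ω N n ≤ W k ω (suc N) (suc n)
  go (≤′-reflexive refl) = gap
  go (≤′-step {N} M≤N) = ≤-trans (+-monoˡ-≤ (W k ω (suc N) n) (m≤m+n ε _))
    (grow-step {k} {ω} {N} 2≤k (full (suc N) L<sN) (full (2 + N) (m≤n⇒m≤1+n L<sN)) (go M≤N))
    where
    L<sN : L < suc N
    L<sN = s≤s (≤-trans L≤M (≤′⇒≤ M≤N))

shift-vanish : ∀ {d e f n} → (∀ j → e < j → f j ≡ 0) → d + e < n → shift d f n ≡ 0
shift-vanish {zero}            vanish e<n       = vanish _ e<n
shift-vanish {suc d} {n = suc n} vanish (s≤s e<n) = shift-vanish {d} vanish e<n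

-- The degree of the product of the [m] with m ≤ N.
degree : ℕ → ℕ → ℕ
degree k zero    = 0
degree k (suc N) = (k ∸ 1) * suc N + degree k N

W-degree : ∀ {k ω} N n → degree k N < n → W k ω N n ≡ 0
W-degree         zero    (suc n) _    = refl
W-degree {k} {ω} (suc N) n       deg< = trans
  (sumTo-cong k λ a a<k → trans
    (cong (ω (suc N) a *_) (shift-vanish (W-degree N)
      (≤-<-trans (+-monoˡ-≤ (degree k N) (*-monoˡ-≤ (suc N) (∸-monoˡ-≤ 1 a<k))) deg<)))
    (*-zeroʳ (ω (suc N) a)))
  (sumTo-zero k)

omit₂-zero : ∀ p x → omit₂ p x 0 ≡ 1
omit₂-zero p x with x ≟ suc p
... | yes refl = update-same (ones [ p ↦ unit ]) x unit 0
... | no x≢q with x ≟ p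
...   | yes refl = trans (update-other (ones [ p ↦ unit ]) (suc p) unit 0 x≢q) (update-same ones x unit 0)
...   | no  x≢p  = omit₂-full x≢p x≢q 0

omit₂-degree : ∀ {k p n} → 1 ≤ k → degree k p < n → W k (omit₂ (suc p)) (2 + p) n ≡ 0
omit₂-degree {k} {p} {n} 1≤k deg< = begin
  W k (omit₂ (suc p)) (2 + p) n
    ≡⟨ factor-cong k (2 + p) (update-same (ones [ suc p ↦ unit ]) (2 + p) unit) (λ _ _ → refl) ⟩
  factor k unit (2 + p) (W k (omit₂ (suc p)) (suc p)) n
    ≡⟨ factor-unit (2 + p) (W k (omit₂ (suc p)) (suc p)) n 1≤k ⟩
  W k (omit₂ (suc p)) (suc p) n
    ≡⟨ factor-cong k (suc p) (λ a → trans (update-other (ones [ suc p ↦ unit ]) (2 + p) unit a (<⇒≢ ≤-refl)) (update-same ones (suc p) unit a)) (λ _ _ → refl) ⟩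
  factor k unit (suc p) (W k (omit₂ (suc p)) p) n
    ≡⟨ factor-unit (suc p) (W k (omit₂ (suc p)) p) n 1≤k ⟩
  W k (omit₂ (suc p)) p n
    ≡⟨ W-degree p n deg< ⟩
  0 ∎
  where open ≡-Reasoning

omit₂-full-beyond : ∀ {p} x → suc p < x → Full (omit₂ p) x
omit₂-full-beyond x q<x = omit₂-full (>⇒≢ (<-trans ≤-refl q<x)) (>⇒≢ q<x)

-- The induction starts at the bound p + 2, where F reduces to a polynomial that vanishes at n.
omit₂-grow : ∀ {k p n N} → 2 ≤ k → degree k p < n → 2 + p ≤ N →
  W k (omit₂ (suc p)) N n ≤ W k (omit₂ (suc p)) (suc N) (suc n)
omit₂-grow {k} {p} 2≤k deg< q≤N = grow 2≤k
  omit₂-full-beyond ≤-refl q≤N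
  (≤-trans (≤-reflexive (omit₂-degree {k} {p} (≤-trans (s≤s z≤n) 2≤k) deg<)) z≤n)

omit₂-fixed : ∀ {k p n N} → 2 ≤ k → n ≤ N → W k (omit₂ p) (suc N) n ≡ W k (omit₂ p) N n
omit₂-fixed {p = p} 2≤k n≤N = W-stable (≤-trans (s≤s z≤n) 2≤k) n≤N (n≤1+n _) (λ x _ → omit₂-zero p x)

late-descent : ∀ {k p n} e → 2 ≤ k → 2 + p ≤ n → suc e + suc (degree k p) ≤ n →
  shift (suc e) (W k (omit₂ (suc p)) n) n ≤ shift e (W k (omit₂ (suc p)) n) n
late-descent {k} {p} {n} e 2≤k q≤n late with m≤n⇒∃[o]m+o≡n late
... | o , eq = begin
  shift (suc e) F n            ≡⟨ cong (shift (suc e) F) n≡ ⟩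
  shift (suc e) F (suc e + m)  ≡⟨ shift-exact (suc e) F m ⟩
  F m                          ≤⟨ omit₂-grow 2≤k (s≤s (m≤m+n _ o)) q≤n ⟩
  W k (omit₂ (suc p)) (suc n) (suc m) ≡⟨ omit₂-fixed 2≤k (≤-trans (s≤s (m≤n+m m e)) (≤-reflexive (sym n≡))) ⟩
  F (suc m)                    ≡⟨ shift-exact e F (suc m) ⟨
  shift e F (e + suc m)        ≡⟨ cong (shift e F) (trans (+-suc e m) (sym n≡)) ⟩
  shift e F n                  ∎
  where
  open ≤-Reasoning
  F = W k (omit₂ (suc p)) n
  m = suc (degree k p + o)
  n≡ : n ≡ suc e + m
  n≡ = trans (sym eq) (+-assoc (suc e) (suc (degree k p)) o)

halve : ∀ n → ∃ λ h → n ≡ 2 * h ⊎ n ≡ 1 + 2 * h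
halve zero = 0 , inj₁ refl
halve (suc n) with halve n
... | h , inj₁ refl = h , inj₂ refl
... | h , inj₂ refl = suc h , inj₁ (lemma h)
  where
  lemma : ∀ h → 2 + 2 * h ≡ 2 * suc h
  lemma = solve-∀

-- Every m ≥ 22 is twice some H ≥ 8, plus either 0 or a prescribed one of 1 and 3.
split : ∀ {c m} → c ≤ 1 → 22 ≤ m → ∃₂ λ h r → 6 ≤ h × m ≡ 2 * (2 + h) + r × (r ≡ 0 ⊎ r ≡ 1 + 2 * c)
split {c} {m} c≤1 22≤m with halve m
... | H , inj₁ refl with m≤n⇒∃[o]m+o≡n (*-cancelˡ-≤ {8} {H} 2 (≤-trans (m≤m+n 16 6) 22≤m))
...   | o , refl = 6 + o , 0 , m≤m+n 6 o , sym (+-identityʳ _) , inj₁ refl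
split {c} {m} c≤1 22≤m | H , inj₂ refl with m≤n⇒∃[o]m+o≡n (≤-trans (+-monoʳ-≤ 8 c≤1) (*-cancelˡ-≤ {9} {H} 2 (≤-trans (m≤m+n 18 3) (s≤s⁻¹ 22≤m))))
...   | o , refl = 6 + o , 1 + 2 * c , m≤m+n 6 o , lemma o c , inj₂ refl
  where
  lemma : ∀ o c → 1 + 2 * (8 + c + o) ≡ 2 * (8 + o) + (1 + 2 * c)
  lemma = solve-∀

omit₂-full-above : ∀ {p x} → 2 + p ≤ x → Full (omit₂ (suc p)) (suc x)
omit₂-full-above q≤x = omit₂-full (>⇒≢ (s≤s (<⇒≤ q≤x))) (>⇒≢ (s≤s q≤x))

shift-positive : ∀ {d r n f} → n ≡ d + r → 1 ≤ f r → 1 ≤ shift d f n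
shift-positive {d} {r} {f = f} refl 1≤fr = ≤-trans 1≤fr (≤-reflexive (sym (shift-exact d f r)))

remainder-positive : ∀ {k p c r N} → 2 ≤ k → 3 ≤ N → c ≤ 1 → 1 ≤ omit₂ (suc p) (1 + 2 * c) 1 →
  r ≡ 0 ⊎ r ≡ 1 + 2 * c → 1 ≤ W k (omit₂ (suc p)) N r
remainder-positive {k} {p} {c} {r} {N} 2≤k 3≤N c≤1 c∈ r≡ = go r≡
  where
  nonzero : ∀ x → 1 ≤ omit₂ (suc p) x 0
  nonzero x = ≤-reflexive (sym (omit₂-zero (suc p) x))
  go : r ≡ 0 ⊎ r ≡ 1 + 2 * c → 1 ≤ W k (omit₂ (suc p)) N r
  go (inj₁ refl) = W-empty {k} {omit₂ (suc p)} N (≤-trans (s≤s z≤n) 2≤k) nonzero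
  go (inj₂ refl) = W-single {k} {omit₂ (suc p)} 2≤k nonzero (s≤s z≤n) (≤-trans (s≤s (*-monoʳ-≤ 2 c≤1)) 3≤N) c∈

-- With H = 2 + h, a partition of n + 1 that is not obtained by enlarging a largest part is
-- H + H + r for k ≥ 3 and (H + 1) + H + r for k = 2. The remainder r is 0 or 1 + 2 c according
-- to parity.
strict-growth : ∀ {k p c n} → 2 ≤ k → p ≤ 3 → c ≤ 1 → 1 ≤ omit₂ (suc p) (1 + 2 * c) 1 →
  degree k p < n → 22 ≤ n →
  ∃ λ M → 2 + p ≤ M × M ≤ n × 1 + W k (omit₂ (suc p)) M n ≤ W k (omit₂ (suc p)) (suc M) (suc n)
strict-growth {k} {p} {c} {n} 2≤k p≤3 c≤1 c∈ deg< 22≤n with m≤n⇒m<n∨m≡n 2≤k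
... | inj₂ refl with split {c} c≤1 22≤n
...   | h , r , 6≤h , n≡ , r≡ =
  2 + h , s≤s (<⇒≤ q≤h) , ≤-trans (m≤m+n (2 + h) _) (≤-trans (m≤m+n (2 * (2 + h)) r) (≤-reflexive (sym n≡))) ,
  ≤-trans
    (+-monoˡ-≤ (W 2 ω (2 + h) n)
      (shift-positive {2 * (2 + h)} {f = W 2 ω (suc h)} n≡
        (remainder-positive {2} {p} 2≤k (≤-trans (m≤m+n 3 4) (s≤s 6≤h)) c≤1 c∈ r≡)))
    (grow-step {2} {ω} {suc h} {ε = 0} 2≤k (omit₂-full-above q≤h) (omit₂-full-above (m≤n⇒m≤1+n q≤h))
      (omit₂-grow 2≤k deg< q≤h))
  where
  ω = omit₂ (suc p)
  q≤h : 2 + p ≤ suc h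
  q≤h = ≤-trans (s≤s (s≤s p≤3)) (≤-trans (m≤m+n 5 2) (s≤s 6≤h))
strict-growth {k} {p} {c} {n} 2≤k p≤3 c≤1 c∈ deg< 22≤n | inj₁ 3≤k with split {c} c≤1 (m≤n⇒m≤1+n 22≤n)
... | h , r , 6≤h , n≡ , r≡ =
  suc h , m≤n⇒m≤1+n q≤h , s≤s⁻¹ (≤-trans (m≤m+n (2 + h) _) (≤-trans (m≤m+n (2 * (2 + h)) r) (≤-reflexive (sym n≡)))) ,
  ≤-trans
    (+-monoˡ-≤ (W k ω (suc h) n)
      (shift-positive {2 * (2 + h)} {f = W k ω (suc h)} n≡
        (remainder-positive {k} {p} 2≤k (≤-trans (m≤m+n 3 4) (s≤s 6≤h)) c≤1 c∈ r≡)))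
    (grow-step₃ {k} {ω} {h} 3≤k (omit₂-full-above q≤h) (omit₂-full-above (m≤n⇒m≤1+n q≤h))
      (omit₂-grow 2≤k deg< q≤h))
  where
  ω = omit₂ (suc p)
  q≤h : 2 + p ≤ h
  q≤h = ≤-trans (s≤s (s≤s p≤3)) (≤-trans (m≤m+n 5 1) 6≤h)

-- The pairs (k, p) that are not generic.
data Special : ℕ → ℕ → Set where
  smallest    : ∀ {k} → Special k 1
  two-two     : Special 2 2
  two-three   : Special 2 3
  two-four    : Special 2 4
  three-two   : Special 3 2
  three-three : Special 3 3

-- The numerical conditions for handling the part p + 1 when n ≥ 32: room keeps the coefficients
-- compared beyond the degree of the small parts, slack does so for strict growth, and 1 + 2 c is an
-- odd permitted part, used to adjust parities.
record Margin (k p : ℕ) : Set where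
  field
    p≤3   : p ≤ 3
    room  : k * (suc p + (2 + p)) + degree k p ≤ 31
    slack : degree k p ≤ 21
    c     : ℕ
    c≤1   : c ≤ 1
    c∈    : 1 ≤ omit₂ (suc p) (1 + 2 * c) 1

-- For the part 1 the odd part is 3, otherwise it is 1.
margin : ∀ {k p} → k ≤ 10 → Special k (suc p) → Margin k p
margin k≤10 smallest = record
  { p≤3 = z≤n ; room = ≤-trans (≤-reflexive (+-identityʳ _)) (≤-trans (*-monoˡ-≤ 3 k≤10) (m≤m+n 30 1))
  ; slack = z≤n ; c = 1 ; c≤1 = ≤-refl ; c∈ = ≤-refl }
margin _ two-two = record
  { p≤3 = m≤m+n 1 2 ; room = m≤m+n 11 20
  ; slack = m≤m+n 1 20 ; c = 0 ; c≤1 = z≤n ; c∈ = ≤-refl }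
margin _ two-three = record
  { p≤3 = m≤m+n 2 1 ; room = m≤m+n 17 14
  ; slack = m≤m+n 3 18 ; c = 0 ; c≤1 = z≤n ; c∈ = ≤-refl }
margin _ two-four = record
  { p≤3 = m≤m+n 3 0 ; room = m≤m+n 24 7
  ; slack = m≤m+n 6 15 ; c = 0 ; c≤1 = z≤n ; c∈ = ≤-refl }
margin _ three-two = record
  { p≤3 = m≤m+n 1 2 ; room = m≤m+n 17 14
  ; slack = m≤m+n 2 19 ; c = 0 ; c≤1 = z≤n ; c∈ = ≤-refl }
margin _ three-three = record
  { p≤3 = m≤m+n 2 1 ; room = m≤m+n 27 4
  ; slack = m≤m+n 6 15 ; c = 0 ; c≤1 = z≤n ; c∈ = ≤-refl }

special-strict : ∀ {k p n} → 2 ≤ k → Margin k p → 32 ≤ n →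
  1 + shift (2 + p) (W k (omit₂ (suc p)) n) n ≤ shift (suc p) (W k (omit₂ (suc p)) n) n
special-strict {k} {p} {n} 2≤k mg 32≤n with m≤n⇒∃[o]m+o≡n q+22≤n
  where
  q+22≤n : 2 + p + 22 ≤ n
  q+22≤n = ≤-trans (+-monoˡ-≤ 22 (s≤s (s≤s (Margin.p≤3 mg)))) (≤-trans (m≤m+n 27 5) 32≤n)
... | o , eq with strict-growth {n = 22 + o} 2≤k (Margin.p≤3 mg) (Margin.c≤1 mg) (Margin.c∈ mg)
                    (<-≤-trans (s≤s (Margin.slack mg)) (m≤m+n 22 o)) (m≤m+n 22 o)
...   | M , q≤M , M≤m , gap = begin
  1 + shift (2 + p) F n            ≡⟨ cong (λ z → 1 + shift (2 + p) F z) n≡ ⟩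
  1 + shift (2 + p) F (2 + p + m)  ≡⟨ cong suc (shift-exact (2 + p) F m) ⟩
  1 + F m                          ≤⟨ grow 2≤k omit₂-full-beyond q≤M
                                        (≤-trans M≤m (≤-trans (m≤n+m m (2 + p)) (≤-reflexive (sym n≡)))) gap ⟩
  W k (omit₂ (suc p)) (suc n) (suc m) ≡⟨ omit₂-fixed 2≤k (≤-trans (m≤n+m (suc m) (suc p)) (≤-reflexive (trans (+-suc (suc p) m) (sym n≡)))) ⟩
  F (suc m)                        ≡⟨ shift-exact (suc p) F (suc m) ⟨
  shift (suc p) F (suc p + suc m)  ≡⟨ cong (shift (suc p) F) (trans (+-suc (suc p) m) (sym n≡)) ⟩
  shift (suc p) F n                ∎
  where
  open ≤-Reasoning
  F = W k (omit₂ (suc p)) n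
  m = 22 + o
  n≡ : n ≡ 2 + p + m
  n≡ = trans (sym eq) (+-assoc (2 + p) 22 o)

special-decreasing : ∀ {k p n} → 2 ≤ k → k ≤ 10 → Special k p → 32 ≤ n → T k (suc p) n < T k p n
special-decreasing {p = zero}  2≤k k≤10 () 32≤n
special-decreasing {k} {suc p} {n} 2≤k k≤10 special 32≤n = T-compare {1} 2≤k (s≤s z≤n)
  (≤-trans (s≤s (s≤s (Margin.p≤3 mg))) (≤-trans (m≤m+n 5 27) 32≤n))
  (λ e e< → late-descent e 2≤k (≤-trans (s≤s (s≤s (Margin.p≤3 mg))) (≤-trans (m≤m+n 5 27) 32≤n))
    (≤-trans (+-mono-≤ e< (≤-refl {suc (degree k p)})) (≤-trans (≤-reflexive (+-suc _ _)) (≤-trans (s≤s (Margin.room mg)) 32≤n))))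
  (special-strict 2≤k mg 32≤n)
  where
  mg = margin k≤10 special

-- Tables for n < 32

-- The entry at an index, 0 beyond the end of the list.
nth : List ℕ → ℕ → ℕ
nth []       _       = 0
nth (x ∷ _)  zero    = x
nth (_ ∷ xs) (suc i) = nth xs i

sweep : ℕ → ℕ → (ℕ → ℕ) → ℕ → List ℕ → List ℕ
sweep b k w m l = applyUpTo (factor k w m (nth l)) b

-- The coefficients of W k ω N below degree b. Every row is computed from the list of the previous
-- values, so that they are shared.
table : ℕ → ℕ → Weights → ℕ → List ℕ
table b k ω zero    = applyUpTo δ b
table b k ω (suc N) = sweep b k (ω (suc N)) (suc N) (table b k ω N)

-- The values T k p n for p ≤ n ≤ b.
occurrenceTable : ℕ → ℕ → ℕ → List ℕ
occurrenceTable b k p = table (suc b) k (ones [ p ↦ id ]) b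

-- l′ lies below l at the indices n < b, strictly from 17 on; for k = 2 only from 9 on.
Dominates : ℕ → ℕ → List ℕ → List ℕ → Set
Dominates b k l l′ = ∀ {n} → n < b → (9 ≤ n ⊎ 3 ≤ k → nth l′ n ≤ nth l n) × (17 ≤ n → nth l′ n < nth l n)

dominates? : ∀ b k l l′ → Dec (Dominates b k l l′)
dominates? b k l l′ = allUpTo? (λ n → ((9 ≤? n ⊎-dec 3 ≤? k) →-dec nth l′ n ≤? nth l n) ×-dec (17 ≤? n →-dec nth l′ n <? nth l n)) b

nth-applyUpTo : ∀ (f : ℕ → ℕ) {b i} → i < b → nth (applyUpTo f b) i ≡ f i
nth-applyUpTo f {suc b} {zero}  _         = refl
nth-applyUpTo f {suc b} {suc i} (s≤s i<b) = nth-applyUpTo (f ∘ suc) i<b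

table-correct : ∀ {b} k ω N {i} → i < b → nth (table b k ω N) i ≡ W k ω N i
table-correct k ω zero    i<b = nth-applyUpTo δ i<b
table-correct {b} k ω (suc N) i<b = trans
  (nth-applyUpTo (factor k (ω (suc N)) (suc N) (nth (table b k ω N))) i<b)
  (factor-cong k {ω (suc N)} (suc N) (λ _ → refl) (λ j j≤i → table-correct k ω N (≤-<-trans j≤i i<b)))

occurrenceTable-correct : ∀ {b k p n} → 1 ≤ k → p ≤ n → n ≤ b → nth (occurrenceTable b k p) n ≡ T k p n
occurrenceTable-correct {b} {k} {p} {n} 1≤k p≤n n≤b = trans
  (table-correct k (ones [ p ↦ id ]) b (s≤s n≤b))
  (W-stable 1≤k ≤-refl n≤b (λ x n<x → update-other ones p id 0 (>⇒≢ (≤-<-trans p≤n n<x))))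

TableAntitone : ℕ → ℕ → Set
TableAntitone b k = ∀ {p} → p < 9 → Dominates b k (occurrenceTable b k (1 + p)) (occurrenceTable b k (2 + p))

tableAntitone? : ∀ b k → Dec (TableAntitone b k)
tableAntitone? b k = allUpTo? (λ p → dominates? b k (occurrenceTable b k (1 + p)) (occurrenceTable b k (2 + p))) 9

-- Checked by evaluation.
tables-antitone : ∀ {k} → k < 11 → 2 ≤ k → TableAntitone 32 k
tables-antitone = from-yes (allUpTo? (λ k → 2 ≤? k →-dec tableAntitone? 32 k) 11)

-- Monotonicity of the number of occurrences

-- The bound b stays a variable here, which keeps the tables unevaluated.
table⇒T : ∀ {b k p n} → 2 ≤ k → TableAntitone b k → 1 ≤ p → p ≤ 9 → suc p ≤ n → n < b →
  (9 ≤ n ⊎ 3 ≤ k → T k (suc p) n ≤ T k p n) × (17 ≤ n → T k (suc p) n < T k p n)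
table⇒T {b} {k} {suc p} {n} 2≤k antitone _ p≤9 q≤n n<b =
  (λ large → subst₂ _≤_ q-correct p-correct (proj₁ dominates large)) ,
  (λ 17≤n → subst₂ _<_ q-correct p-correct (proj₂ dominates 17≤n))
  where
  dominates = antitone p≤9 n<b
  1≤k = ≤-trans (s≤s z≤n) 2≤k
  p-correct = occurrenceTable-correct {b} {k} {suc p} {n} 1≤k (<⇒≤ q≤n) (<⇒≤ n<b)
  q-correct = occurrenceTable-correct {b} {k} {2 + p} {n} 1≤k q≤n (<⇒≤ n<b)

classify : ∀ {k p} → 2 ≤ k → 1 ≤ p → Special k p ⊎ Generic k p
classify {1} (s≤s ()) _
classify {k} {1} _ _ = inj₁ smallest
classify {2} {2} _ _ = inj₁ two-two
classify {2} {3} _ _ = inj₁ two-three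
classify {2} {4} _ _ = inj₁ two-four
classify {2} {suc (suc (suc (suc (suc p))))} _ _ = inj₂ record { p≥2 = m≤m+n 2 _ ; k≡2 = λ _ → m≤m+n 5 p ; k≡3 = λ () }
classify {3} {2} _ _ = inj₁ three-two
classify {3} {3} _ _ = inj₁ three-three
classify {3} {suc (suc (suc (suc p)))} _ _ = inj₂ record { p≥2 = m≤m+n 2 _ ; k≡2 = λ () ; k≡3 = λ _ → m≤m+n 4 p }
classify {suc (suc (suc (suc k)))} {suc (suc p)} _ _ = inj₂ record { p≥2 = m≤m+n 2 p ; k≡2 = λ () ; k≡3 = λ () }

T-antitone : ∀ {k p n} → 2 ≤ k → k ≤ 10 → 1 ≤ p → suc p ≤ n → 9 ≤ n ⊎ 3 ≤ k → T k (suc p) n ≤ T k p n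
T-antitone {k} {p} {n} 2≤k k≤10 1≤p q≤n large with classify 2≤k 1≤p | n <? 32
... | inj₂ generic | _        = generic-antitone 2≤k generic q≤n
... | inj₁ special | no n≮32  = <⇒≤ (special-decreasing 2≤k k≤10 special (≮⇒≥ n≮32))
... | inj₁ special | yes n<32 = proj₁ (table⇒T 2≤k (tables-antitone (s≤s k≤10) 2≤k) 1≤p (p≤9 special) q≤n n<32) large
  where
  p≤9 : ∀ {k p} → Special k p → p ≤ 9
  p≤9 smallest    = m≤m+n 1 8
  p≤9 two-two     = m≤m+n 2 7
  p≤9 two-three   = m≤m+n 3 6
  p≤9 two-four    = m≤m+n 4 5
  p≤9 three-two   = m≤m+n 2 7
  p≤9 three-three = m≤m+n 3 6

T-decreasing : ∀ {k p n} → 2 ≤ k → k ≤ 10 → 1 ≤ p → p ≤ 9 → 17 ≤ n → T k (suc p) n < T k p n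
T-decreasing {k} {p} {n} 2≤k k≤10 1≤p p≤9 17≤n with n <? 32 | classify 2≤k 1≤p
... | yes n<32 | _            = proj₂ (table⇒T 2≤k (tables-antitone (s≤s k≤10) 2≤k) 1≤p p≤9 (≤-trans (s≤s p≤9) (≤-trans (m≤m+n 10 7) 17≤n)) n<32) 17≤n
... | no n≮32  | inj₁ special = special-decreasing 2≤k k≤10 special (≮⇒≥ n≮32)
... | no n≮32  | inj₂ generic = generic-decreasing 2≤k k≤10 p≤9 generic (≮⇒≥ n≮32)

-- Enumerating regular partitions by the multiplicity of the largest part

∈-shiftBy⁻ : ∀ {A : Set} {x : A} d f n → x ∈ shiftBy [] d f n → ∃ λ m → d + m ≡ n × x ∈ f m
∈-shiftBy⁻ zero    f n       x∈ = n , refl , x∈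
∈-shiftBy⁻ (suc d) f (suc n) x∈ with ∈-shiftBy⁻ d f n x∈
... | m , refl , x∈f = m , refl , x∈f

-- The concatenation of f 0, …, f (k - 1).
collect : ∀ {A : Set} → ℕ → (ℕ → List A) → List A
collect zero    f = []
collect (suc k) f = collect k f ++ f k

∈-collect⁻ : ∀ {A : Set} {x : A} k f → x ∈ collect k f → ∃ λ a → a < k × x ∈ f a
∈-collect⁻ (suc k) f x∈ with ∈-++⁻ (collect k f) x∈
... | inj₂ x∈fk = k , ≤-refl , x∈fk
... | inj₁ x∈c with ∈-collect⁻ k f x∈c
...   | a , a<k , x∈fa = a , m<n⇒m<1+n a<k , x∈fa

∈-collect⁺ : ∀ {A : Set} {x : A} {k a} f → a < k → x ∈ f a → x ∈ collect k f
∈-collect⁺ {k = suc k} {a} f (s≤s a≤k) x∈ with m≤n⇒m<n∨m≡n a≤k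
... | inj₁ a<k  = ∈-++⁺ˡ (∈-collect⁺ f a<k x∈)
... | inj₂ refl = ∈-++⁺ʳ (collect k f) x∈

-- Partitions of n with exactly a parts x, the others being enumerated by f.
blocks : ℕ → ℕ → (ℕ → List (List ℕ)) → ℕ → ℕ → List (List ℕ)
blocks k x f n a = map (replicate a x ++_) (shiftBy [] (a * x) f n)

-- The partitions of n into parts at most N with multiplicities less than k.
bounded : ℕ → ℕ → ℕ → List (List ℕ)
bounded k zero    zero    = [ [] ]
bounded k zero    (suc n) = []
bounded k (suc N) n       = collect k (blocks k (suc N) (bounded k N) n)

multiplicity-++ : ∀ x ps qs → multiplicity x (ps ++ qs) ≡ multiplicity x ps + multiplicity x qs
multiplicity-++ x ps qs = trans (cong length (filter-++ (x ≟_) ps qs)) (length-++ (filter (x ≟_) ps))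

multiplicity-absent : ∀ {x ps} → All (x ≢_) ps → multiplicity x ps ≡ 0
multiplicity-absent {x} x∉ = cong length (filter-none (x ≟_) x∉)

multiplicity-above : ∀ {N x ps} → All (_≤ N) ps → N < x → multiplicity x ps ≡ 0
multiplicity-above ps≤N N<x = multiplicity-absent (All.map (λ p≤N → >⇒≢ (≤-<-trans p≤N N<x)) ps≤N)

multiplicity-block : ∀ {N ps} a → All (_≤ N) ps → multiplicity (suc N) (replicate a (suc N) ++ ps) ≡ a
multiplicity-block {N} {ps} a ps≤N = begin
  multiplicity (suc N) (replicate a (suc N) ++ ps)
    ≡⟨ multiplicity-++ (suc N) (replicate a (suc N)) ps ⟩
  multiplicity (suc N) (replicate a (suc N)) + multiplicity (suc N) ps
    ≡⟨ cong₂ _+_ (trans (cong length (filter-all (suc N ≟_) (All.replicate⁺ a refl))) (length-replicate a))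
                 (multiplicity-above ps≤N ≤-refl) ⟩
  a + 0
    ≡⟨ +-identityʳ a ⟩
  a ∎
  where open ≡-Reasoning

multiplicity-skip : ∀ {x y ps} a → x ≢ y → multiplicity x (replicate a y ++ ps) ≡ multiplicity x ps
multiplicity-skip {x} {y} {ps} a x≢y = trans (multiplicity-++ x (replicate a y) ps)
  (cong (_+ multiplicity x ps) (multiplicity-absent (All.replicate⁺ a x≢y)))

sum-block : ∀ a x ps → sum (replicate a x ++ ps) ≡ a * x + sum ps
sum-block zero    x ps = refl
sum-block (suc a) x ps = trans (cong (x +_) (sum-block a x ps)) (sym (+-assoc x (a * x) (sum ps)))

-- The k-regular partitions of n into parts at most N. Regularity is required for all x, not only
-- for the parts of ps.
record IsBounded (k N n : ℕ) (ps : List ℕ) : Set where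
  constructor isBounded
  field
    descending : Linked _≥_ ps
    positive   : All (1 ≤_) ps
    parts≤     : All (_≤ N) ps
    sum≡       : sum ps ≡ n
    regular    : ∀ x → multiplicity x ps < k

linked-block : ∀ {N ps} a → All (_≤ N) ps → Linked _≥_ ps → Linked _≥_ (replicate a (suc N) ++ ps)
linked-block                 zero          ps≤N         linked = linked
linked-block {ps = []}       (suc zero)    ps≤N         linked = [-]
linked-block {ps = p ∷ ps}   (suc zero)    (p≤N ∷ ps≤N) linked = m≤n⇒m≤1+n p≤N ∷ linked
linked-block                 (suc (suc a)) ps≤N         linked = ≤-refl ∷ linked-block (suc a) ps≤N linked

bounded-sound : ∀ {k} N n {ps} → 1 ≤ k → ps ∈ bounded k N n → IsBounded k N n ps
bounded-sound zero zero 1≤k (here refl) = isBounded [] [] [] refl (λ _ → 1≤k)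
bounded-sound {k} (suc N) n 1≤k ps∈ with ∈-collect⁻ k _ ps∈
... | a , a<k , ps∈block with ∈-map⁻ (replicate a (suc N) ++_) ps∈block
...   | qs , qs∈ , refl with ∈-shiftBy⁻ (a * suc N) (bounded k N) n qs∈
...     | m , refl , qs∈m with bounded-sound N m 1≤k qs∈m
...       | isBounded linked pos qs≤N refl reg = isBounded
  (linked-block a qs≤N linked)
  (All.++⁺ (All.replicate⁺ a (s≤s z≤n)) pos)
  (All.++⁺ (All.replicate⁺ a ≤-refl) (All.map m≤n⇒m≤1+n qs≤N))
  (sum-block a (suc N) qs)
  regular
  where
  regular : ∀ x → multiplicity x (replicate a (suc N) ++ qs) < k
  regular x with x ≟ suc N
  ... | yes refl = ≤-<-trans (≤-reflexive (multiplicity-block a qs≤N)) a<k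
  ... | no  x≢N  = ≤-<-trans (≤-reflexive (multiplicity-skip a x≢N)) (reg x)

split-block : ∀ {N ps} → Linked _≥_ ps → All (_≤ suc N) ps →
              ∃₂ λ a qs → ps ≡ replicate a (suc N) ++ qs × Linked _≥_ qs × All (_≤ N) qs
split-block {ps = []} linked ps≤ = 0 , [] , refl , [] , []
split-block {N} {p ∷ ps} linked (p≤ ∷ ps≤) with m≤n⇒m<n∨m≡n p≤
... | inj₁ (s≤s p≤N) = 0 , p ∷ ps , refl , linked , Linked⇒All (λ x≥y y≥z → ≤-trans y≥z x≥y) p≤N linked
... | inj₂ refl with split-block (Linked.tail linked) ps≤
...   | a , qs , refl , linked′ , qs≤N = suc a , qs , refl , linked′ , qs≤N

bounded-complete : ∀ {k} N n {ps} → IsBounded k N n ps → ps ∈ bounded k N n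
bounded-complete zero n {[]} (isBounded _ _ _ refl _) = here refl
bounded-complete zero n {p ∷ ps} (isBounded _ (1≤p ∷ _) (p≤0 ∷ _) _ _) = contradiction (≤-trans 1≤p p≤0) λ ()
bounded-complete {k} (suc N) n (isBounded linked pos ps≤ refl reg) with split-block linked ps≤
... | a , qs , refl , linked′ , qs≤N = ∈-collect⁺ (blocks k (suc N) (bounded k N) n) a<k
  (∈-map⁺ (replicate a (suc N) ++_) (subst (qs ∈_) (sym shifted) (bounded-complete N (sum qs) tail)))
  where
  a<k : a < k
  a<k = ≤-<-trans (≤-reflexive (sym (multiplicity-block a qs≤N))) (reg (suc N))
  shifted : shiftBy [] (a * suc N) (bounded k N) (sum (replicate a (suc N) ++ qs)) ≡ bounded k N (sum qs)
  shifted = trans (cong (shiftBy [] (a * suc N) (bounded k N)) (sum-block a (suc N) qs))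
                  (shiftBy-exact (a * suc N) (bounded k N) (sum qs))
  tail : IsBounded k N (sum qs) qs
  tail = isBounded linked′ (All.++⁻ʳ (replicate a (suc N)) pos) qs≤N refl λ x →
    ≤-<-trans (≤-trans (m≤n+m (multiplicity x qs) (multiplicity x (replicate a (suc N))))
                       (≤-reflexive (sym (multiplicity-++ x (replicate a (suc N)) qs)))) (reg x)

-- The lists f a are disjoint since a can be recovered from the elements of f a.
collect-unique : ∀ {A : Set} k (f : ℕ → List A) (μ : A → ℕ) → (∀ a → Unique (f a)) →
                 (∀ {a x} → x ∈ f a → μ x ≡ a) → Unique (collect k f)
collect-unique zero    f μ unique label = []
collect-unique (suc k) f μ unique label = Unique.++⁺ (collect-unique k f μ unique label) (unique k) disjoint
  where
  disjoint : ∀ {x} → ¬ (x ∈ collect k f × x ∈ f k)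
  disjoint (x∈c , x∈fk) with ∈-collect⁻ k f x∈c
  ... | a , a<k , x∈fa = <⇒≢ a<k (trans (sym (label x∈fa)) (label x∈fk))

shiftBy-unique : ∀ {A : Set} d (f : ℕ → List A) n → (∀ m → Unique (f m)) → Unique (shiftBy [] d f n)
shiftBy-unique zero    f n       unique = unique n
shiftBy-unique (suc d) f zero    unique = []
shiftBy-unique (suc d) f (suc n) unique = shiftBy-unique d f n unique

bounded-unique : ∀ {k} N n → 1 ≤ k → Unique (bounded k N n)
bounded-unique zero    zero    1≤k = [] ∷ []
bounded-unique zero    (suc n) 1≤k = []
bounded-unique {k} (suc N) n   1≤k = collect-unique k _ (multiplicity (suc N))
  (λ a → Unique.map⁺ (++-cancelˡ (replicate a (suc N)) _ _)
    (shiftBy-unique (a * suc N) (bounded k N) n (λ m → bounded-unique N m 1≤k)))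
  label
  where
  label : ∀ {a ps} → ps ∈ blocks k (suc N) (bounded k N) n a → multiplicity (suc N) ps ≡ a
  label {a} ps∈ with ∈-map⁻ (replicate a (suc N) ++_) ps∈
  ... | qs , qs∈ , refl with ∈-shiftBy⁻ (a * suc N) (bounded k N) n qs∈
  ...   | m , _ , qs∈m = multiplicity-block a (IsBounded.parts≤ (bounded-sound N m 1≤k qs∈m))

regularPartitions↭bounded : ∀ {k} n → 1 ≤ k → regularPartitions k n ↭ bounded k n n
regularPartitions↭bounded {k} n 1≤k = ∼bag⇒↭ (unique∧set⇒bag (regularPartitions-unique k n) (bounded-unique n n 1≤k) (mk⇔ to from))
  where
  to : ∀ {ps} → ps ∈ regularPartitions k n → ps ∈ bounded k n n
  to {ps} ps∈ with Equivalence.to ∈-regularPartitions ps∈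
  ... | (linked , pos , sum≡n) , regular = bounded-complete n n
    (isBounded linked pos (subst (λ m → All (_≤ m) ps) sum≡n (parts≤sum ps)) sum≡n everywhere)
    where
    everywhere : ∀ x → multiplicity x ps < k
    everywhere x with All.all? (λ y → ¬? (x ≟ y)) ps
    ... | yes x∉ = ≤-<-trans (≤-reflexive (multiplicity-absent x∉)) 1≤k
    ... | no ¬x∉ = occurs regular λ x∈ → ¬x∉ x∈
      where
      -- Not being absent, x is one of the parts that regularity speaks about.
      occurs : ∀ {qs} → All (λ p → multiplicity p ps < k) qs → ¬ All (x ≢_) qs → multiplicity x ps < k
      occurs []               ¬all = contradiction [] ¬all
      occurs {q ∷ qs} (q<k ∷ qs<k) ¬all with x ≟ q
      ... | yes refl = q<k
      ... | no x≢q   = occurs qs<k λ all → ¬all (x≢q ∷ all)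
  from : ∀ {ps} → ps ∈ bounded k n n → ps ∈ regularPartitions k n
  from ps∈ with bounded-sound n n 1≤k ps∈
  ... | isBounded linked pos _ sum≡n reg = Equivalence.from ∈-regularPartitions
    ((linked , pos , sum≡n) , All.tabulate (λ {x} _ → reg x))

-- The product of the weights of the multiplicities of 1, …, N.
weight : Weights → ℕ → List ℕ → ℕ
weight ω zero    ps = 1
weight ω (suc N) ps = ω (suc N) (multiplicity (suc N) ps) * weight ω N ps

weight-cong : ∀ ω N {ps qs} → (∀ x → x ≤ N → multiplicity x ps ≡ multiplicity x qs) → weight ω N ps ≡ weight ω N qs
weight-cong ω zero    eq = refl
weight-cong ω (suc N) eq = cong₂ _*_ (cong (ω (suc N)) (eq (suc N) ≤-refl)) (weight-cong ω N (λ x x≤N → eq x (m≤n⇒m≤1+n x≤N)))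

weight-block : ∀ ω {N ps} a → All (_≤ N) ps → weight ω (suc N) (replicate a (suc N) ++ ps) ≡ ω (suc N) a * weight ω N ps
weight-block ω {N} a ps≤N = cong₂ _*_ (cong (ω (suc N)) (multiplicity-block a ps≤N))
  (weight-cong ω N (λ x x≤N → multiplicity-skip a (<⇒≢ (s≤s x≤N))))

sum-map-* : ∀ {A : Set} c (f : A → ℕ) xs → sum (map (λ x → c * f x) xs) ≡ c * sum (map f xs)
sum-map-* c f []       = sym (*-zeroʳ c)
sum-map-* c f (x ∷ xs) = trans (cong (c * f x +_) (sum-map-* c f xs)) (sym (*-distribˡ-+ c (f x) (sum (map f xs))))

sum-map-collect : ∀ {A : Set} k (φ : A → ℕ) f → sum (map φ (collect k f)) ≡ sumTo k (λ a → sum (map φ (f a)))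
sum-map-collect zero    φ f = refl
sum-map-collect (suc k) φ f = trans (cong sum (map-++ φ (collect k f) (f k)))
  (trans (sum-++ (map φ (collect k f)) (map φ (f k))) (cong (_+ sum (map φ (f k))) (sum-map-collect k φ f)))

sum-map-shiftBy : ∀ {A : Set} d (φ : A → ℕ) f n → sum (map φ (shiftBy [] d f n)) ≡ shift d (λ m → sum (map φ (f m))) n
sum-map-shiftBy zero    φ f n       = refl
sum-map-shiftBy (suc d) φ f zero    = refl
sum-map-shiftBy (suc d) φ f (suc n) = sum-map-shiftBy d φ f n

weight-sum : ∀ {k} ω N n → 1 ≤ k → sum (map (weight ω N) (bounded k N n)) ≡ W k ω N n
weight-sum ω zero    zero    1≤k = refl
weight-sum ω zero    (suc n) 1≤k = refl
weight-sum {k} ω (suc N) n   1≤k = trans (sum-map-collect k (weight ω (suc N)) _) (sumTo-cong k λ a _ → begin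
  sum (map (weight ω (suc N)) (map (replicate a (suc N) ++_) (block a)))
    ≡⟨ cong sum (map-∘ (block a)) ⟨
  sum (map (weight ω (suc N) ∘ (replicate a (suc N) ++_)) (block a))
    ≡⟨ cong sum (map-cong-local (All.tabulate (λ ps∈ → weight-block ω a (parts≤N a ps∈)))) ⟩
  sum (map (λ ps → ω (suc N) a * weight ω N ps) (block a))
    ≡⟨ sum-map-* (ω (suc N) a) (weight ω N) (block a) ⟩
  ω (suc N) a * sum (map (weight ω N) (block a))
    ≡⟨ cong (ω (suc N) a *_) (trans (sum-map-shiftBy (a * suc N) (weight ω N) (bounded k N) n)
         (shift-cong (a * suc N) (λ m _ → weight-sum ω N m 1≤k))) ⟩
  ω (suc N) a * shift (a * suc N) (W k ω N) n ∎)
  where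
  open ≡-Reasoning
  block : ℕ → List (List ℕ)
  block a = shiftBy [] (a * suc N) (bounded k N) n
  parts≤N : ∀ a {ps} → ps ∈ block a → All (_≤ N) ps
  parts≤N a ps∈ with ∈-shiftBy⁻ (a * suc N) (bounded k N) n ps∈
  ... | m , _ , ps∈m = IsBounded.parts≤ (bounded-sound N m 1≤k ps∈m)

weight-multiplicity : ∀ {p N} ps → 1 ≤ p → p ≤ N → weight (ones [ p ↦ id ]) N ps ≡ multiplicity p ps
weight-multiplicity {p} {N} ps 1≤p p≤N = go (≤⇒≤′ p≤N) 1≤p
  where
  ω = ones [ p ↦ id ]
  below : ∀ M → M < p → weight ω M ps ≡ 1
  below zero    _   = refl
  below (suc M) M<p = cong₂ _*_ (update-other ones p id (multiplicity (suc M) ps) (<⇒≢ M<p)) (below M (<-trans ≤-refl M<p))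
  go : ∀ {M} → p ≤′ M → 1 ≤ p → weight ω M ps ≡ multiplicity p ps
  go {suc M} (≤′-reflexive refl) _ = trans
    (cong₂ _*_ (update-same ones p id (multiplicity p ps)) (below M ≤-refl)) (*-identityʳ _)
  go {suc M} (≤′-step p≤M) 1≤p = trans
    (cong₂ _*_ (update-other ones p id (multiplicity (suc M) ps) (>⇒≢ (s≤s (≤′⇒≤ p≤M)))) (go p≤M 1≤p)) (*-identityˡ _)

T-sum : ∀ {k p n} → 1 ≤ k → 1 ≤ p → p ≤ n → sum (map (multiplicity p) (bounded k n n)) ≡ T k p n
T-sum {k} {p} {n} 1≤k 1≤p p≤n = trans
  (cong sum (map-cong-local {xs = bounded k n n} (All.tabulate (λ {ps} _ → sym (weight-multiplicity ps 1≤p p≤n)))))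
  (weight-sum (ones [ p ↦ id ]) n n 1≤k)

-- 1 if x ≡ r modulo t, and 0 otherwise.
indicator : ℕ → ℕ → ℕ → ℕ
indicator t r x = if does (x ≡? r [mod t ]) then 1 else 0

length-filter-∷ : ∀ {A : Set} {P : A → Set} (P? : Decidable P) x xs →
  length (filter P? (x ∷ xs)) ≡ (if does (P? x) then 1 else 0) + length (filter P? xs)
length-filter-∷ P? x xs with does (P? x)
... | true  = refl
... | false = refl

sumTo-delta : ∀ n (c : ℕ → ℕ) {x} → 1 ≤ x → x ≤ n → sumTo n (λ i → c (suc i) * (if does (suc i ≟ x) then 1 else 0)) ≡ c x
sumTo-delta zero    c 1≤x x≤0 = contradiction (≤-trans 1≤x x≤0) λ ()
sumTo-delta (suc n) c {x} 1≤x x≤sn with m≤n⇒m<n∨m≡n x≤sn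
... | inj₁ (s≤s x≤n) rewrite dec-false (suc n ≟ x) (>⇒≢ (s≤s x≤n)) =
  trans (cong₂ _+_ (sumTo-delta n c 1≤x x≤n) (*-zeroʳ (c (suc n)))) (+-identityʳ (c x))
... | inj₂ refl rewrite dec-true (suc n ≟ suc n) refl =
  trans (cong₂ _+_ (trans (sumTo-cong n vanish) (sumTo-zero n)) (*-identityʳ (c (suc n)))) refl
  where
  vanish : ∀ i → i < n → c (suc i) * (if does (suc i ≟ suc n) then 1 else 0) ≡ 0
  vanish i i<n rewrite dec-false (suc i ≟ suc n) (<⇒≢ (s≤s i<n)) = *-zeroʳ (c (suc i))

partsCongruentTo-sum : ∀ {r t n ps} → All (1 ≤_) ps → All (_≤ n) ps →
  partsCongruentTo r t ps ≡ sumTo n (λ i → indicator t r (suc i) * multiplicity (suc i) ps)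
partsCongruentTo-sum {r} {t} {n} [] [] = sym (trans (sumTo-cong n (λ i _ → *-zeroʳ (indicator t r (suc i)))) (sumTo-zero n))
partsCongruentTo-sum {r} {t} {n} {p ∷ ps} (1≤p ∷ pos) (p≤n ∷ ps≤n) = begin
  partsCongruentTo r t (p ∷ ps)
    ≡⟨ length-filter-∷ (_≡? r [mod t ]) p ps ⟩
  indicator t r p + partsCongruentTo r t ps
    ≡⟨ cong₂ _+_ (sym (sumTo-delta n (indicator t r) 1≤p p≤n)) (partsCongruentTo-sum pos ps≤n) ⟩
  sumTo n (λ i → indicator t r (suc i) * (if does (suc i ≟ p) then 1 else 0)) +
  sumTo n (λ i → indicator t r (suc i) * multiplicity (suc i) ps)
    ≡⟨ sumTo-+ n _ _ ⟨
  sumTo n (λ i → indicator t r (suc i) * (if does (suc i ≟ p) then 1 else 0) + indicator t r (suc i) * multiplicity (suc i) ps)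
    ≡⟨ sumTo-cong n (λ i _ → trans (sym (*-distribˡ-+ (indicator t r (suc i)) _ _))
         (cong (indicator t r (suc i) *_) (sym (length-filter-∷ (suc i ≟_) p ps)))) ⟩
  sumTo n (λ i → indicator t r (suc i) * multiplicity (suc i) (p ∷ ps)) ∎
  where open ≡-Reasoning

sum-map-sumTo : ∀ {A : Set} n (g : A → ℕ → ℕ) xs → sum (map (λ x → sumTo n (g x)) xs) ≡ sumTo n (λ i → sum (map (λ x → g x i) xs))
sum-map-sumTo n g []       = sym (sumTo-zero n)
sum-map-sumTo n g (x ∷ xs) = trans (cong (sumTo n (g x) +_) (sum-map-sumTo n g xs)) (sym (sumTo-+ n (g x) _))

D-sum : ∀ {k r t n} → 1 ≤ k → D k r t n ≡ sumTo n (λ i → indicator t r (suc i) * T k (suc i) n)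
D-sum {k} {r} {t} {n} 1≤k = begin
  sum (map (partsCongruentTo r t) (regularPartitions k n))
    ≡⟨ sum-↭ (↭-map⁺ (partsCongruentTo r t) (regularPartitions↭bounded n 1≤k)) ⟩
  sum (map (partsCongruentTo r t) (bounded k n n))
    ≡⟨ cong sum (map-cong-local (All.tabulate λ ps∈ → let b = bounded-sound n n 1≤k ps∈ in
         partsCongruentTo-sum (IsBounded.positive b) (IsBounded.parts≤ b))) ⟩
  sum (map (λ ps → sumTo n (λ i → indicator t r (suc i) * multiplicity (suc i) ps)) (bounded k n n))
    ≡⟨ sum-map-sumTo n _ (bounded k n n) ⟩
  sumTo n (λ i → sum (map (λ ps → indicator t r (suc i) * multiplicity (suc i) ps) (bounded k n n)))
    ≡⟨ sumTo-cong n (λ i i<n → trans (sum-map-* (indicator t r (suc i)) (multiplicity (suc i)) (bounded k n n))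
         (cong (indicator t r (suc i) *_) (T-sum 1≤k (s≤s z≤n) i<n))) ⟩
  sumTo n (λ i → indicator t r (suc i) * T k (suc i) n) ∎
  where open ≡-Reasoning

sumTo-suc : ∀ n g → sumTo (suc n) g ≡ g 0 + sumTo n (g ∘ suc)
sumTo-suc zero    g = +-comm 0 (g 0)
sumTo-suc (suc n) g = trans (cong (_+ g (suc n)) (sumTo-suc n g)) (+-assoc (g 0) _ _)

-- No part 1 is counted for the residue r + 1.
indicator-first : ∀ {t r} → 1 ≤ r → r < t → indicator t (suc r) 1 ≡ 0
indicator-first {t} {r@(suc _)} _ r<t rewrite dec-false (t ∣? r) (>⇒∤ r<t) = refl

indicator-self : ∀ t r → indicator t r r ≡ 1
indicator-self t r rewrite dec-true (r ≡? r [mod t ]) (subst (t ∣_) (sym (∣n-n∣≡0 r)) (t ∣0)) = refl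

sumTo-mono-< : ∀ {k a} {f g : ℕ → ℕ} → a < k → (∀ i → i < k → f i ≤ g i) → f a < g a → sumTo k f < sumTo k g
sumTo-mono-< {suc k} {a} a<sk le lt with m≤n⇒m<n∨m≡n (s≤s⁻¹ a<sk)
... | inj₁ a<k  = +-mono-<-≤ (sumTo-mono-< a<k (λ i i<k → le i (m<n⇒m<1+n i<k)) lt) (le k ≤-refl)
... | inj₂ refl = +-mono-≤-< (sumTo-mono k (λ i i<k → le i (m<n⇒m<1+n i<k))) lt

-- The parts i + 2 ≡ r + 1 correspond to the parts i + 1 ≡ r.
D-suc : ∀ {k r t n} → 1 ≤ k → 1 ≤ r → r < t → D k (suc r) t (suc n) ≡ sumTo n (λ i → indicator t r (suc i) * T k (2 + i) (suc n))
D-suc {k} {r} {t} {n} 1≤k 1≤r r<t = trans (D-sum {k} {suc r} {t} {suc n} 1≤k)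
  (trans (sumTo-suc n _) (cong (λ z → z * T k 1 (suc n) + sumTo n (λ i → indicator t r (suc i) * T k (2 + i) (suc n))) (indicator-first 1≤r r<t)))

D-antitone-step : ∀ {k r t n} → 1 ≤ k → 1 ≤ r → r < t → (∀ {p} → 1 ≤ p → suc p ≤ n → T k (suc p) n ≤ T k p n) →
  D k (suc r) t n ≤ D k r t n
D-antitone-step {k} {r} {t} {zero} 1≤k 1≤r r<t T-antitone = ≤-reflexive (trans (D-sum {k} {suc r} {t} {0} 1≤k) (sym (D-sum {k} {r} {t} {0} 1≤k)))
D-antitone-step {k} {r} {t} {suc n} 1≤k 1≤r r<t T-antitone = begin
  D k (suc r) t (suc n)                                          ≡⟨ D-suc {k} {r} {t} {n} 1≤k 1≤r r<t ⟩
  sumTo n (λ i → indicator t r (suc i) * T k (2 + i) (suc n))    ≤⟨ sumTo-mono n (λ i i<n → *-monoʳ-≤ (indicator t r (suc i)) (T-antitone (s≤s z≤n) (s≤s i<n))) ⟩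
  sumTo n (λ i → indicator t r (suc i) * T k (suc i) (suc n))    ≤⟨ m≤m+n _ _ ⟩
  sumTo (suc n) (λ i → indicator t r (suc i) * T k (suc i) (suc n)) ≡⟨ D-sum {k} {r} {t} {suc n} 1≤k ⟨
  D k r t (suc n) ∎
  where open ≤-Reasoning

-- The strict inequality comes from the smallest part in the class, which is r itself.
D-decreasing-step : ∀ {k r t n} → 1 ≤ k → 1 ≤ r → r < t → r < n → (∀ {p} → 1 ≤ p → suc p ≤ n → T k (suc p) n ≤ T k p n) →
  T k (suc r) n < T k r n → D k (suc r) t n < D k r t n
D-decreasing-step {k} {r@(suc r′)} {t} {suc n} 1≤k 1≤r r<t r<n T-antitone T-decreasing = begin-strict
  D k (suc r) t (suc n)                                          ≡⟨ D-suc {k} {r} {t} {n} 1≤k 1≤r r<t ⟩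
  sumTo n (λ i → indicator t r (suc i) * T k (2 + i) (suc n))    <⟨ sumTo-mono-< {n} {r′} (s≤s⁻¹ r<n) (λ i i<n → *-monoʳ-≤ (indicator t r (suc i)) (T-antitone (s≤s z≤n) (s≤s i<n))) at-r ⟩
  sumTo n (λ i → indicator t r (suc i) * T k (suc i) (suc n))    ≤⟨ m≤m+n _ _ ⟩
  sumTo (suc n) (λ i → indicator t r (suc i) * T k (suc i) (suc n)) ≡⟨ D-sum {k} {r} {t} {suc n} 1≤k ⟨
  D k r t (suc n) ∎
  where
  open ≤-Reasoning
  at-r : indicator t r r * T k (suc r) (suc n) < indicator t r r * T k r (suc n)
  at-r rewrite indicator-self t r | *-identityˡ (T k (suc r) (suc n)) | *-identityˡ (T k r (suc n)) = T-decreasing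

D-antitone : ∀ {k r s t n} → 1 ≤ k → 1 ≤ r → r ≤ s → s ≤ t → (∀ {p} → 1 ≤ p → suc p ≤ n → T k (suc p) n ≤ T k p n) →
  D k s t n ≤ D k r t n
D-antitone {k} {r} {s} {t} {n} 1≤k 1≤r r≤s s≤t T-antitone = go (≤⇒≤′ r≤s) s≤t
  where
  go : ∀ {s} → r ≤′ s → s ≤ t → D k s t n ≤ D k r t n
  go (≤′-reflexive refl) _ = ≤-refl
  go (≤′-step {s} r≤s) s<t = ≤-trans (D-antitone-step {k} {s} {t} {n} 1≤k (≤-trans 1≤r (≤′⇒≤ r≤s)) s<t T-antitone) (go r≤s (<⇒≤ s<t))

theorem1p3 : ∀ (k t r s : ℕ) →
    2 ≤ k → k ≤ 10 →
    2 ≤ t → t ≤ 10 →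
    1 ≤ r → r < s → s ≤ t →
    ((3 ≤ k → ∀ (n : ℕ) → n ≥ 1 → D k r t n ≥ D k s t n)
    × (k ≡ 2 → ∀ (n : ℕ) → n ≥ 9 → D k r t n ≥ D k s t n))
    × (∀ (n : ℕ) → n ≥ 17 → D k r t n > D k s t n)
theorem1p3 k t r s 2≤k k≤10 _ t≤10 1≤r r<s s≤t =
  ((λ 3≤k n _ → weak n (inj₂ 3≤k)) , (λ _ n 9≤n → weak n (inj₁ 9≤n))) , strong
  where
  1≤k = ≤-trans (s≤s z≤n) 2≤k
  weak : ∀ n → 9 ≤ n ⊎ 3 ≤ k → D k s t n ≤ D k r t n
  weak n large = D-antitone {k} {r} {s} {t} {n} 1≤k 1≤r (<⇒≤ r<s) s≤t
    (λ 1≤p p<n → T-antitone 2≤k k≤10 1≤p p<n large)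
  strong : ∀ n → 17 ≤ n → D k s t n < D k r t n
  strong n 17≤n = ≤-<-trans
    (D-antitone {k} {suc r} {s} {t} {n} 1≤k (s≤s z≤n) r<s s≤t antitone)
    (D-decreasing-step {k} {r} {t} {n} 1≤k 1≤r r<t (≤-trans r<t (≤-trans t≤10 (≤-trans (m≤m+n 10 7) 17≤n))) antitone
      (T-decreasing 2≤k k≤10 1≤r r≤9 17≤n))
    where
    r<t = <-≤-trans r<s s≤t
    r≤9 : r ≤ 9
    r≤9 = s≤s⁻¹ (≤-trans r<t t≤10)
    antitone : ∀ {p} → 1 ≤ p → suc p ≤ n → T k (suc p) n ≤ T k p n
    antitone 1≤p p<n = T-antitone 2≤k k≤10 1≤p p<n (inj₁ (≤-trans (m≤m+n 9 8) 17≤n))
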